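{- Let $p$ be an odd prime and let $a\in\mathbb{Z}_p$. Then $$\int_{\mathbb{Z}_p}\cos(ax)\,d\mu_{ -1}(x)=1,\qquad \int_{\mathbb{Z}_p}\sin(ax)\,d\mu_{ -1}(x)=-\frac{\sin a}{\cos a+1}=-\tan\frac a2.$$
   Context: Here $\sin$ and $\cos$ are the $p$-adic functions given by their usual power series and $\tan=\sin/\cos$. For a strictly differentiable function $f$ on $\mathbb{Z}_p$ (i.e. $f\in C^{(1)}(\mathbb{Z}_p)$), the fermionic $p$-adic integral (the $p$-adic $q$-integral at $q=-1$) is $$\int_{\mathbb{Z}_p}f(x)\,d\mu_{ -1}(x)=\lim_{N\to\infty}\sum_{x=0}^{p^N-1}f(x)(-1)^x.$$
   Formalization: The p-adic power series of sin and cos diverge at units of Z_p (e.g. p = 3, a = 1), so the claim is stated for those a in Z_p at which both series converge, which are exactly the a in pZ_p. -}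

module Defs where

open import Level using (0ℓ)
open import Algebra.Bundles using (CommutativeRing)
import Algebra.Definitions
open import Data.Fin.Base using (toℕ)
import Data.Fin.Properties as Fin
open import Data.Integer.Base as ℤ using (ℤ; +_)
import Data.Integer.Properties as ℤ
open import Data.Nat.Base as ℕ using (ℕ; zero; suc; _≤_; _⊔_; _!; NonZero)
import Data.Nat.Properties as ℕ
open import Data.Nat.Divisibility
open import Data.Nat.Primality using (Prime; euclidsLemma; prime⇒nonTrivial; prime⇒nonZero)
open import Data.Nat.Induction using (<-wellFounded)
open import Induction.WellFounded using (Acc; acc)
open import Data.Nat.Solver renaming (module +-*-Solver to ℕ-Solver)
import Data.Nat.DivMod as DivMod
open import Data.Product.Base using (∃-syntax; _×_; _,_; proj₁; proj₂)
open import Data.Rational.Base as ℚ using (ℚ; 0ℚ; 1ℚ; ½; ↥_; ↧_; ↧ₙ_; _/_)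
import Data.Rational.Properties as ℚ
open import Data.Rational.Unnormalised.Base as ℚᵘ using (*≡*; mkℚᵘ)
import Data.Rational.Unnormalised.Properties as ℚᵘ
open import Data.Rational.Solver using (module +-*-Solver)
open import Data.Sum.Base using ([_,_]′)
open import Function.Base using (_∘_)
open import Relation.Nullary using (¬_; yes; no)
open import Relation.Binary.PropositionalEquality
  using (_≡_; refl; sym; trans; cong; cong₂; subst; module ≡-Reasoning)

module Padic (p : ℕ) (p-prime : Prime p) where

  module ℚ-Exp where
    open import Algebra.Properties.Semiring.Exp
      (CommutativeRing.semiring ℚ.+-*-commutativeRing) public
  open ℚ-Exp using () renaming (_^_ to _^ᵠ_)

  ----------------------------------------------------------------------
  -- The p-adic topology on ℚ

  pℚ : ℚ
  pℚ = + p / 1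

  -- Membership in ℤ₍ₚ₎; denominators are in lowest terms.
  p-Integral : ℚ → Set
  p-Integral x = ¬ (p ∣ ↧ₙ x)

  infix 4 ∣_∣ᵠ≤p^-_

  -- ∣ x ∣ₚ ≤ p⁻ᵏ, i.e. x ∈ pᵏℤ₍ₚ₎
  record ∣_∣ᵠ≤p^-_ (x : ℚ) (k : ℕ) : Set where
    constructor ball
    field
      cofactor          : ℚ
      cofactor-integral : p-Integral cofactor
      x≡pᵏ*cofactor     : x ≡ (pℚ ^ᵠ k) ℚ.* cofactor

  ∤-* : ∀ {m n} → ¬ (p ∣ m) → ¬ (p ∣ n) → ¬ (p ∣ m ℕ.* n)
  ∤-* {m} {n} p∤m p∤n = [ p∤m , p∤n ]′ ∘ euclidsLemma m n p-prime

  p∤1 : ¬ (p ∣ 1)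
  p∤1 p∣1 with refl ← ∣1⇒≡1 p∣1 with () ← prime⇒nonTrivial p-prime

  ∣-from-ℤ : ∀ {a b} {c : ℤ} → + a ℤ.* c ≡ + b → a ∣ b
  ∣-from-ℤ {a} {b} {c} eq = divides ℤ.∣ c ∣
    (trans (cong ℤ.∣_∣ (sym eq)) (trans (ℤ.abs-* (+ a) c) (ℕ.*-comm a ℤ.∣ c ∣)))

  ↧+∣ : ∀ x y → ↧ₙ (x ℚ.+ y) ∣ ↧ₙ x ℕ.* ↧ₙ y
  ↧+∣ x@record{} y@record{} = ∣-from-ℤ (ℚ.↧-+ x y)

  ↧*∣ : ∀ x y → ↧ₙ (x ℚ.* y) ∣ ↧ₙ x ℕ.* ↧ₙ y
  ↧*∣ x@record{} y@record{} = ∣-from-ℤ (ℚ.↧-* x y)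

  /-integral : ∀ i n .{{_ : NonZero n}} → ¬ (p ∣ n) → p-Integral (i / n)
  /-integral i n p∤n p∣ = p∤n (∣-trans p∣ (∣-from-ℤ (ℚ.↧-/ i n)))

  +-integral : ∀ x y → p-Integral x → p-Integral y → p-Integral (x ℚ.+ y)
  +-integral x y hx hy p∣ = ∤-* hx hy (∣-trans p∣ (↧+∣ x y))

  *-integral : ∀ x y → p-Integral x → p-Integral y → p-Integral (x ℚ.* y)
  *-integral x y hx hy p∣ = ∤-* hx hy (∣-trans p∣ (↧*∣ x y))

  neg-integral : ∀ x → p-Integral x → p-Integral (ℚ.- x)
  neg-integral x hx p∣ = hx (subst (p ∣_) (ℤ.+-injective (ℚ.↧-neg x)) p∣)

  pᵏ-integral : ∀ k → p-Integral (pℚ ^ᵠ k)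
  pᵏ-integral zero    = p∤1
  pᵏ-integral (suc k) = *-integral pℚ (pℚ ^ᵠ k) (/-integral (+ p) 1 p∤1) (pᵏ-integral k)

  ball-0 : ∀ k → ∣ 0ℚ ∣ᵠ≤p^- k
  ball-0 k = ball 0ℚ p∤1 (sym (ℚ.*-zeroʳ (pℚ ^ᵠ k)))

  ball-+ : ∀ {k x y} → ∣ x ∣ᵠ≤p^- k → ∣ y ∣ᵠ≤p^- k → ∣ x ℚ.+ y ∣ᵠ≤p^- k
  ball-+ {k} (ball u hu refl) (ball v hv refl) =
    ball (u ℚ.+ v) (+-integral u v hu hv) (sym (ℚ.*-distribˡ-+ (pℚ ^ᵠ k) u v))

  ball-neg : ∀ {k x} → ∣ x ∣ᵠ≤p^- k → ∣ ℚ.- x ∣ᵠ≤p^- k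
  ball-neg {k} (ball u hu refl) =
    ball (ℚ.- u) (neg-integral u hu) (ℚ.neg-distribʳ-* (pℚ ^ᵠ k) u)

  ball-weaken : ∀ {k l x} → k ≤ l → ∣ x ∣ᵠ≤p^- l → ∣ x ∣ᵠ≤p^- k
  ball-weaken {k} {l} k≤l (ball u hu refl) =
    ball (pℚ ^ᵠ (l ℕ.∸ k) ℚ.* u) (*-integral (pℚ ^ᵠ (l ℕ.∸ k)) u (pᵏ-integral (l ℕ.∸ k)) hu)
    (trans (cong (ℚ._* u) (trans (cong (pℚ ^ᵠ_) (sym (ℕ.m+[n∸m]≡n k≤l)))
                                (ℚ-Exp.^-homo-* pℚ k (l ℕ.∸ k))))
          (ℚ.*-assoc (pℚ ^ᵠ k) (pℚ ^ᵠ (l ℕ.∸ k)) u))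

  -- If ∣ x ∣ ≤ pᵇ and ∣ y ∣ ≤ p⁻ᵏ⁻ᵇ then ∣ x y ∣ ≤ p⁻ᵏ.
  ball-* : ∀ {b k x y} → p-Integral (pℚ ^ᵠ b ℚ.* x) →
           ∣ y ∣ᵠ≤p^- (k ℕ.+ b) → ∣ x ℚ.* y ∣ᵠ≤p^- k
  ball-* {b} {k} {x} hx (ball u hu refl) =
    ball ((pℚ ^ᵠ b ℚ.* x) ℚ.* u) (*-integral (pℚ ^ᵠ b ℚ.* x) u hx hu)
    (trans (cong (λ e → x ℚ.* (e ℚ.* u)) (ℚ-Exp.^-homo-* pℚ k b))
      (solve 4 (λ x P B u → x :* ((P :* B) :* u) := P :* ((B :* x) :* u)) refl
        x (pℚ ^ᵠ k) (pℚ ^ᵠ b) u))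
    where open +-*-Solver

  split-p : ∀ n → .{{_ : NonZero n}} → Acc ℕ._<_ n →
            ∃[ b ] ∃[ u ] ¬ (p ∣ u) × n ≡ p ℕ.^ b ℕ.* u
  split-p n (acc rec) with p ∣? n
  ... | no  p∤n = 0 , n , p∤n , sym (ℕ.+-identityʳ n)
  ... | yes p∣n@(divides q refl) =
    let instance
          _ = ℕ.m*n≢0⇒m≢0 q
          _ = prime⇒nonTrivial p-prime
        b , u , p∤u , q≡ = split-p q (rec (quotient-< p∣n))
    in suc b , u , p∤u ,
       trans (ℕ.*-comm q p) (trans (cong (p ℕ.*_) q≡) (sym (ℕ.*-assoc p (p ℕ.^ b) u)))

  pᵏ≡ : ∀ k → pℚ ^ᵠ k ≡ + (p ℕ.^ k) / 1
  pᵏ≡ zero    = refl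
  pᵏ≡ (suc k) = trans (cong (pℚ ℚ.*_) (pᵏ≡ k))
    (ℚ.toℚᵘ-injective (ℚᵘ.≃-trans (ℚ.toℚᵘ-homo-* pℚ (+ (p ℕ.^ k) / 1))
      (ℚᵘ.≃-trans (ℚᵘ.*-cong (ℚ.toℚᵘ-fromℚᵘ (mkℚᵘ (+ p) 0)) (ℚ.toℚᵘ-fromℚᵘ (mkℚᵘ (+ (p ℕ.^ k)) 0)))
        (ℚᵘ.≃-trans (*≡* (cong (ℤ._* + 1) (sym (ℤ.pos-* p (p ℕ.^ k)))))
          (ℚᵘ.≃-sym (ℚ.toℚᵘ-fromℚᵘ (mkℚᵘ (+ (p ℕ.* p ℕ.^ k)) 0)))))))

  /-cancel : ∀ m i d n .{{_ : NonZero d}} .{{_ : NonZero n}} → n ≡ m ℕ.* d →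
             (+ m / 1) ℚ.* (i / n) ≡ i / d
  /-cancel m i d@(suc d-1) n@(suc n-1) n≡ =
    ℚ.toℚᵘ-injective (ℚᵘ.≃-trans (ℚ.toℚᵘ-homo-* (+ m / 1) (i / n))
      (ℚᵘ.≃-trans (ℚᵘ.*-cong (ℚ.toℚᵘ-fromℚᵘ (mkℚᵘ (+ m) 0)) (ℚ.toℚᵘ-fromℚᵘ (mkℚᵘ i n-1)))
        (ℚᵘ.≃-trans (*≡* cross) (ℚᵘ.≃-sym (ℚ.toℚᵘ-fromℚᵘ (mkℚᵘ i d-1))))))
    where
    open ≡-Reasoning
    cross : (+ m ℤ.* i) ℤ.* + d ≡ i ℤ.* + (1 ℕ.* n)
    cross = begin
      (+ m ℤ.* i) ℤ.* + d   ≡⟨ cong (ℤ._* + d) (ℤ.*-comm (+ m) i) ⟩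
      (i ℤ.* + m) ℤ.* + d   ≡⟨ ℤ.*-assoc i (+ m) (+ d) ⟩
      i ℤ.* (+ m ℤ.* + d)   ≡⟨ cong (i ℤ.*_) (ℤ.pos-* m d) ⟨
      i ℤ.* + (m ℕ.* d)     ≡⟨ cong (λ z → i ℤ.* + z) n≡ ⟨
      i ℤ.* + n             ≡⟨ cong (λ z → i ℤ.* + z) (ℕ.*-identityˡ n) ⟨
      i ℤ.* + (1 ℕ.* n)     ∎

  pᵏ*/-integral : ∀ k i n u .{{_ : NonZero n}} → ¬ (p ∣ u) → n ≡ p ℕ.^ k ℕ.* u →
                  p-Integral (pℚ ^ᵠ k ℚ.* (i / n))
  pᵏ*/-integral k i n u p∤u n≡ = subst p-Integral
    (sym (trans (cong (ℚ._* (i / n)) (pᵏ≡ k)) (/-cancel (p ℕ.^ k) i u n n≡)))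
    (/-integral i u p∤u)
    where
    instance
      u≢0 : NonZero u
      u≢0 = ℕ.m*n≢0⇒n≢0 (p ℕ.^ k) {{ℕ.>-nonZero (subst (0 ℕ.<_) n≡ (ℕ.>-nonZero⁻¹ n))}}

  p-bounded : ∀ x → ∃[ b ] p-Integral (pℚ ^ᵠ b ℚ.* x)
  p-bounded x@record{} =
    let b , u , p∤u , d≡ = split-p (↧ₙ x) (<-wellFounded (↧ₙ x))
    in b , subst (λ y → p-Integral (pℚ ^ᵠ b ℚ.* y)) (ℚ.↥p/↧p≡p x)
             (pᵏ*/-integral b (↥ x) (↧ₙ x) u p∤u d≡)

  ----------------------------------------------------------------------
  -- ℚₚ, the completion of ℚ

  Cauchy : (ℕ → ℚ) → Set
  Cauchy s = ∀ k → ∃[ N ] ∀ {m n} → N ≤ m → N ≤ n → ∣ s m ℚ.- s n ∣ᵠ≤p^- k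

  record ℚₚ : Set where
    no-eta-equality
    constructor mkℚₚ
    field
      seq    : ℕ → ℚ
      cauchy : Cauchy seq

  open ℚₚ public

  infix  4 ∣_∣≤p^-_ _≈_
  infix  8 -_
  infixl 7 _*_
  infixl 6 _+_ _-_

  -- Balls are clopen, so it is enough that almost all terms of a Cauchy
  -- sequence lie in the ball.
  record ∣_∣≤p^-_ (x : ℚₚ) (k : ℕ) : Set where
    constructor eventually
    field
      from : ℕ
      in-ball : ∀ {n} → from ≤ n → ∣ seq x n ∣ᵠ≤p^- k

  eventually-bounded : ∀ x → ∃[ b ] ∃[ N ] ∀ {n} → N ≤ n → p-Integral (pℚ ^ᵠ b ℚ.* seq x n)
  eventually-bounded x =
    let N , h = cauchy x 0
        b , i = p-bounded (seq x N)
    in b , N , λ {n} N≤n →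
      let ball u hu e = h N≤n ℕ.≤-refl
          P = pℚ ^ᵠ b
      in subst p-Integral
           (trans (cong (λ z → P ℚ.* seq x N ℚ.+ P ℚ.* z) (trans (sym (ℚ.*-identityˡ u)) (sym e)))
              (solve 3 (λ P a c → P :* a :+ P :* (c :- a) := P :* c) refl P (seq x N) (seq x n)))
           (+-integral (P ℚ.* seq x N) (P ℚ.* u) i (*-integral P u (pᵏ-integral b) hu))
    where open +-*-Solver

  module _ {N M : ℕ} where
    ⊔ˡ : ∀ {n} → N ⊔ M ≤ n → N ≤ n
    ⊔ˡ = ℕ.m⊔n≤o⇒m≤o N M
    ⊔ʳ : ∀ {n} → N ⊔ M ≤ n → M ≤ n
    ⊔ʳ = ℕ.m⊔n≤o⇒n≤o N M

  *-diff : ∀ a b c d → a ℚ.* (c ℚ.- d) ℚ.+ d ℚ.* (a ℚ.- b) ≡ a ℚ.* c ℚ.- b ℚ.* d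
  *-diff = solve 4 (λ a b c d → a :* (c :- d) :+ d :* (a :- b) := a :* c :- b :* d) refl
    where open +-*-Solver

  abstract
    const-cauchy : ∀ q → Cauchy λ _ → q
    const-cauchy q k = 0 , λ _ _ → subst (∣_∣ᵠ≤p^- k) (sym (ℚ.+-inverseʳ q)) (ball-0 k)

    +-cauchy : ∀ x y → Cauchy λ n → seq x n ℚ.+ seq y n
    +-cauchy x y k =
      let N , h = cauchy x k
          M , g = cauchy y k
      in N ⊔ M , λ {m} {n} lm ln → subst (∣_∣ᵠ≤p^- k)
           (solve 4 (λ a b c d → (a :- b) :+ (c :- d) := (a :+ c) :- (b :+ d)) refl
              (seq x m) (seq x n) (seq y m) (seq y n))
           (ball-+ (h (⊔ˡ lm) (⊔ˡ ln)) (g (⊔ʳ {N} lm) (⊔ʳ {N} ln)))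
      where open +-*-Solver

    neg-cauchy : ∀ x → Cauchy λ n → ℚ.- seq x n
    neg-cauchy x k =
      let N , h = cauchy x k
      in N , λ {m} {n} lm ln → subst (∣_∣ᵠ≤p^- k)
           (ℚ.neg-distrib-+ (seq x m) (ℚ.- seq x n)) (ball-neg (h lm ln))

    *-cauchy : ∀ x y → Cauchy λ n → seq x n ℚ.* seq y n
    *-cauchy x y k =
      let bx , Bx , ix = eventually-bounded x
          by , By , iy = eventually-bounded y
          N , h = cauchy x (k ℕ.+ by)
          M , g = cauchy y (k ℕ.+ bx)
      in (Bx ⊔ By) ⊔ (N ⊔ M) , λ {m} {n} lm ln → subst (∣_∣ᵠ≤p^- k)
           (*-diff (seq x m) (seq x n) (seq y m) (seq y n))
           (ball-+ (ball-* {bx} {k} (ix (⊔ˡ {Bx} (⊔ˡ {Bx ⊔ By} lm)))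
                                    (g (⊔ʳ {N} (⊔ʳ {Bx ⊔ By} lm)) (⊔ʳ {N} (⊔ʳ {Bx ⊔ By} ln))))
                   (ball-* {by} {k} (iy (⊔ʳ {Bx} (⊔ˡ {Bx ⊔ By} ln)))
                                    (h (⊔ˡ {N} (⊔ʳ {Bx ⊔ By} lm)) (⊔ˡ {N} (⊔ʳ {Bx ⊔ By} ln)))))

  ι : ℚ → ℚₚ
  ι q = mkℚₚ (λ _ → q) (const-cauchy q)

  _+_ : ℚₚ → ℚₚ → ℚₚ
  x + y = mkℚₚ (λ n → seq x n ℚ.+ seq y n) (+-cauchy x y)

  -_ : ℚₚ → ℚₚ
  - x = mkℚₚ (λ n → ℚ.- seq x n) (neg-cauchy x)

  _*_ : ℚₚ → ℚₚ → ℚₚ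
  x * y = mkℚₚ (λ n → seq x n ℚ.* seq y n) (*-cauchy x y)

  _-_ : ℚₚ → ℚₚ → ℚₚ
  x - y = x + (- y)

  record _≈_ (x y : ℚₚ) : Set where
    constructor mk≈
    field
      close : ∀ k → ∣ x - y ∣≤p^- k

  open _≈_ public

  Ball-+ : ∀ {k x y} → ∣ x ∣≤p^- k → ∣ y ∣≤p^- k → ∣ x + y ∣≤p^- k
  Ball-+ (eventually N h) (eventually M g) =
    eventually (N ⊔ M) λ l → ball-+ (h (⊔ˡ l)) (g (⊔ʳ {N} l))

  Ball-neg : ∀ {k x} → ∣ x ∣≤p^- k → ∣ - x ∣≤p^- k
  Ball-neg (eventually N h) = eventually N λ l → ball-neg (h l)

  Ball-weaken : ∀ {k l x} → k ≤ l → ∣ x ∣≤p^- l → ∣ x ∣≤p^- k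
  Ball-weaken k≤l (eventually N h) = eventually N λ l → ball-weaken k≤l (h l)

  Ball-* : ∀ {k x y} → ∣ x ∣≤p^- k → ∣ y ∣≤p^- 0 → ∣ x * y ∣≤p^- k
  Ball-* {k} (eventually N h) (eventually M g) = eventually (N ⊔ M) λ l →
    let ball u hu e = h (⊔ˡ l)
        ball v hv f = g (⊔ʳ {N} l)
    in ball (u ℚ.* v) (*-integral u v hu hv)
         (trans (cong₂ ℚ._*_ e (trans f (ℚ.*-identityˡ v))) (ℚ.*-assoc (pℚ ^ᵠ k) u v))

  Ball-pointwise : ∀ {k} x y → (∀ n → seq x n ≡ seq y n) → ∣ x ∣≤p^- k → ∣ y ∣≤p^- k
  Ball-pointwise {k} x y e (eventually N h) = eventually N λ {n} l → subst (∣_∣ᵠ≤p^- k) (e n) (h l)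

  pointwise : ∀ x y → (∀ n → seq x n ≡ seq y n) → x ≈ y
  pointwise x y e = mk≈ λ k → eventually 0 λ {n} _ → subst (∣_∣ᵠ≤p^- k)
    (sym (trans (cong (ℚ._- seq y n) (e n)) (ℚ.+-inverseʳ (seq y n)))) (ball-0 k)

  ball-sym : ∀ {k x y} → ∣ x - y ∣≤p^- k → ∣ y - x ∣≤p^- k
  ball-sym {_} {x} {y} b = Ball-pointwise (- (x - y)) (y - x)
    (λ n → solve 2 (λ a b → :- (a :- b) := b :- a) refl (seq x n) (seq y n)) (Ball-neg b)
    where open +-*-Solver

  ball-trans : ∀ {k x y z} → ∣ x - y ∣≤p^- k → ∣ y - z ∣≤p^- k → ∣ x - z ∣≤p^- k
  ball-trans {_} {x} {y} {z} b c = Ball-pointwise ((x - y) + (y - z)) (x - z)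
    (λ n → solve 3 (λ a b c → (a :- b) :+ (b :- c) := a :- c) refl (seq x n) (seq y n) (seq z n))
    (Ball-+ b c)
    where open +-*-Solver

  +-cong : ∀ {x x′ y y′} → x ≈ x′ → y ≈ y′ → (x + y) ≈ (x′ + y′)
  +-cong {x} {x′} {y} {y′} e f = mk≈ λ k → Ball-pointwise ((x - x′) + (y - y′)) ((x + y) - (x′ + y′))
    (λ n → solve 4 (λ a b c d → (a :- b) :+ (c :- d) := (a :+ c) :- (b :+ d)) refl
       (seq x n) (seq x′ n) (seq y n) (seq y′ n))
    (Ball-+ (close e k) (close f k))
    where open +-*-Solver

  neg-cong : ∀ {x y} → x ≈ y → (- x) ≈ (- y)
  neg-cong {x} {y} e = mk≈ λ k → Ball-pointwise (- (x - y)) (- x - (- y))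
    (λ n → ℚ.neg-distrib-+ (seq x n) (ℚ.- seq y n)) (Ball-neg (close e k))

  *-cong : ∀ {x x′ y y′} → x ≈ x′ → y ≈ y′ → (x * y) ≈ (x′ * y′)
  *-cong {x} {x′} {y} {y′} e f = mk≈ λ k →
    let bx , Bx , ix = eventually-bounded x
        by , By , iy = eventually-bounded y′
        eventually N h = close e (k ℕ.+ by)
        eventually M g = close f (k ℕ.+ bx)
    in eventually ((Bx ⊔ By) ⊔ (N ⊔ M)) λ {n} l → subst (∣_∣ᵠ≤p^- k)
         (*-diff (seq x n) (seq x′ n) (seq y n) (seq y′ n))
         (ball-+ (ball-* {bx} {k} (ix (⊔ˡ {Bx} (⊔ˡ {Bx ⊔ By} l))) (g (⊔ʳ {N} (⊔ʳ {Bx ⊔ By} l))))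
                 (ball-* {by} {k} (iy (⊔ʳ {Bx} (⊔ˡ {Bx ⊔ By} l))) (h (⊔ˡ {N} (⊔ʳ {Bx ⊔ By} l)))))

  ℚₚ-commutativeRing : CommutativeRing 0ℓ 0ℓ
  ℚₚ-commutativeRing = record
    { Carrier = ℚₚ
    ; _≈_ = _≈_ ; _+_ = _+_ ; _*_ = _*_ ; -_ = -_ ; 0# = ι 0ℚ ; 1# = ι 1ℚ
    ; isCommutativeRing = record
      { isRing = record
        { +-isAbelianGroup = record
          { isGroup = record
            { isMonoid = record
              { isSemigroup = record
                { isMagma = record
                  { isEquivalence = record
                    { refl  = λ {x} → pointwise x x λ _ → refl
                    ; sym   = λ e → mk≈ λ k → ball-sym (close e k)
                    ; trans = λ e f → mk≈ λ k → ball-trans (close e k) (close f k)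
                    }
                  ; ∙-cong = +-cong
                  }
                ; assoc = λ x y z → pointwise (x + y + z) (x + (y + z))
                    λ n → ℚ.+-assoc (seq x n) (seq y n) (seq z n)
                }
              ; identity = (λ x → pointwise (ι 0ℚ + x) x λ n → ℚ.+-identityˡ (seq x n))
                         , (λ x → pointwise (x + ι 0ℚ) x λ n → ℚ.+-identityʳ (seq x n))
              }
            ; inverse = (λ x → pointwise (- x + x) (ι 0ℚ) λ n → ℚ.+-inverseˡ (seq x n))
                      , (λ x → pointwise (x + - x) (ι 0ℚ) λ n → ℚ.+-inverseʳ (seq x n))
            ; ⁻¹-cong = neg-cong
            }
          ; comm = λ x y → pointwise (x + y) (y + x) λ n → ℚ.+-comm (seq x n) (seq y n)
          }
        ; *-cong = *-cong
        ; *-assoc = λ x y z → pointwise (x * y * z) (x * (y * z))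
            λ n → ℚ.*-assoc (seq x n) (seq y n) (seq z n)
        ; *-identity = (λ x → pointwise (ι 1ℚ * x) x λ n → ℚ.*-identityˡ (seq x n))
                     , (λ x → pointwise (x * ι 1ℚ) x λ n → ℚ.*-identityʳ (seq x n))
        ; distrib = (λ x y z → pointwise (x * (y + z)) (x * y + x * z)
                       λ n → ℚ.*-distribˡ-+ (seq x n) (seq y n) (seq z n))
                  , (λ x y z → pointwise ((y + z) * x) (y * x + z * x)
                       λ n → ℚ.*-distribʳ-+ (seq x n) (seq y n) (seq z n))
        }
      ; *-comm = λ x y → pointwise (x * y) (y * x) λ n → ℚ.*-comm (seq x n) (seq y n)
      }
    }

  open CommutativeRing ℚₚ-commutativeRing public using (0#; 1#)
  module R = CommutativeRing ℚₚ-commutativeRing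
  module ΣR where
    open import Algebra.Properties.Monoid.Sum R.+-monoid public
  module ^R where
    open import Algebra.Properties.CommutativeSemiring.Exp R.commutativeSemiring public
  open ΣR public using (sum)
  open ^R public using (_^_)

  -- As ℚₚ is a field, this is the positive form of x ≠ 0.
  Invertible : ℚₚ → Set
  Invertible = Algebra.Definitions.Invertible _≈_ 1# _*_

  infixl 7 _÷_⟨_⟩
  _÷_⟨_⟩ : ℚₚ → (y : ℚₚ) → Invertible y → ℚₚ
  x ÷ y ⟨ y⁻¹ , _ ⟩ = x * y⁻¹

  ----------------------------------------------------------------------
  -- ℤₚ, the closed unit ball

  record ℤₚ : Set where
    constructor mkℤₚ
    field
      value    : ℚₚ
      integral : ∣ value ∣≤p^- 0

  open ℤₚ public

  ι-integral : ∀ {q} → p-Integral q → ∣ ι q ∣≤p^- 0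
  ι-integral {q} i = eventually 0 λ _ → ball q i (sym (ℚ.*-identityˡ q))

  fromℕ : ℕ → ℤₚ
  fromℕ n = mkℤₚ (ι (+ n / 1)) (ι-integral (/-integral (+ n) 1 p∤1))

  ½ₚ : ¬ (2 ∣ p) → ℤₚ
  ½ₚ p-odd = mkℤₚ (ι ½) (ι-integral p∤2)
    where
    p∤2 : ¬ (p ∣ 2)
    p∤2 p∣2 = p-odd (subst (2 ∣_) (sym p≡2) ∣-refl)
      where
      p≡2 : p ≡ 2
      p≡2 = ℕ.≤-antisym (∣⇒≤ p∣2) (ℕ.nonTrivial⇒n>1 p {{prime⇒nonTrivial p-prime}})

  ----------------------------------------------------------------------
  -- Limits and series

  infix 4 _⟶_
  _⟶_ : (ℕ → ℚₚ) → ℚₚ → Set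
  s ⟶ l = ∀ k → ∃[ N ] ∀ {n} → N ≤ n → ∣ s n - l ∣≤p^- k

  Converges : (ℕ → ℚₚ) → Set
  Converges s = ∃[ l ] s ⟶ l

  partialSum : (ℕ → ℚₚ) → ℕ → ℚₚ
  partialSum t n = sum {n} λ i → t (toℕ i)

  ι-ball : ∀ {k} a b → ∣ ι a - ι b ∣≤p^- k → ∣ a ℚ.- b ∣ᵠ≤p^- k
  ι-ball a b (eventually _ h) = h ℕ.≤-refl

  complete : (s : ℕ → ℚₚ) →
             (∀ k → ∃[ N ] ∀ {m n} → N ≤ m → N ≤ n → ∣ s m - s n ∣≤p^- k) → Converges s
  complete s s-cauchy = L , conv
    where
    N : ℕ → ℕ
    N k = proj₁ (s-cauchy k)
    M : ℕ → ℕ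
    M k = proj₁ (cauchy (s (N k)) k)
    l : ℕ → ℚ
    l k = seq (s (N k)) (M k)
    approx : ∀ k → ∣ s (N k) - ι (l k) ∣≤p^- k
    approx k = eventually (M k) λ le → proj₂ (cauchy (s (N k)) k) le ℕ.≤-refl
    near : ∀ {k n i} → k ≤ i → N k ≤ n → ∣ s n - ι (l i) ∣≤p^- k
    near {k} {n} {i} k≤i Nk≤n =
      ball-trans (proj₂ (s-cauchy k) Nk≤n (ℕ.m≤m⊔n (N k) (N i)))
        (ball-trans (Ball-weaken k≤i (proj₂ (s-cauchy i) (ℕ.m≤n⊔m (N k) (N i)) ℕ.≤-refl))
                    (Ball-weaken k≤i (approx i)))
    l-close : ∀ {k m n} → k ≤ m → k ≤ n → ∣ l m ℚ.- l n ∣ᵠ≤p^- k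
    l-close {k} {m} {n} k≤m k≤n = ι-ball (l m) (l n)
      (ball-trans {y = s (N k)} (ball-sym (near k≤m ℕ.≤-refl)) (near k≤n ℕ.≤-refl))
    L : ℚₚ
    L = mkℚₚ l λ k → k , l-close
    conv : s ⟶ L
    conv k = N k , λ Nk≤n → ball-trans {y = ι (l k)} (near ℕ.≤-refl Nk≤n)
      (eventually k (l-close ℕ.≤-refl))

  ≈⇒ball : ∀ {k x y} → x ≈ y → ∣ x ∣≤p^- k → ∣ y ∣≤p^- k
  ≈⇒ball {k} {x} {y} e b = Ball-pointwise (x - (x - y)) y
    (λ n → solve 2 (λ a c → a :- (a :- c) := c) refl (seq x n) (seq y n))
    (Ball-+ b (Ball-neg (close e k)))
    where open +-*-Solver

  partialSum-suc : ∀ t n → partialSum t (suc n) ≈ (partialSum t n + t n)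
  partialSum-suc t n = R.trans (ΣR.sum-init-last {n} (t ∘ toℕ))
    (R.reflexive (cong₂ _+_ (ΣR.sum-cong-≗ {n} λ i → cong t (Fin.toℕ-inject₁ i))
                            (cong t (Fin.toℕ-fromℕ n))))

  Null : (ℕ → ℚₚ) → Set
  Null t = ∀ k → ∃[ N ] ∀ {n} → N ≤ n → ∣ t n ∣≤p^- k

  x+y-x≈y : ∀ x y → ((x + y) - x) ≈ y
  x+y-x≈y x y = pointwise ((x + y) - x) y λ i →
    solve 2 (λ a c → (a :+ c) :- a := c) refl (seq x i) (seq y i)
    where open +-*-Solver

  term≈ : ∀ t n → (partialSum t (suc n) - partialSum t n) ≈ t n
  term≈ t n = R.trans (R.+-congʳ (partialSum-suc t n)) (x+y-x≈y (partialSum t n) (t n))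

  terms-null : ∀ t → Converges (partialSum t) → Null t
  terms-null t (l , h) k = let N , g = h k in N , λ {n} N≤n →
    ≈⇒ball (term≈ t n) (ball-trans (g (ℕ.m≤n⇒m≤1+n N≤n)) (ball-sym (g N≤n)))

  null-converges : ∀ t → Null t → Converges (partialSum t)
  null-converges t t-null = complete S λ k →
    proj₁ (t-null k) , λ N≤m N≤n → ball-trans (from-N k N≤m) (ball-sym (from-N k N≤n))
    where
    S = partialSum t
    from-N : ∀ k {n} → proj₁ (t-null k) ≤ n → ∣ S n - S (proj₁ (t-null k)) ∣≤p^- k
    from-N k {n} N≤n = subst (λ n → ∣ S n - S N ∣≤p^- k) (ℕ.m∸n+n≡m N≤n) (go (n ℕ.∸ N))
      where
      N = proj₁ (t-null k)
      go : ∀ d → ∣ S (d ℕ.+ N) - S N ∣≤p^- k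
      go zero    = close (R.refl {S N}) k
      go (suc d) = ball-trans
        (≈⇒ball (R.sym (term≈ t (d ℕ.+ N))) (proj₂ (t-null k) (ℕ.m≤n+m N d)))
        (go d)

  ^-ball : ∀ x n → ∣ x ∣≤p^- 0 → ∣ x ^ n ∣≤p^- 0
  ^-ball x zero    h = ι-integral p∤1
  ^-ball x (suc n) h = Ball-* h (^-ball x n h)

  module _ (c : ℕ → ℚ) (e : ℕ → ℕ) (a x : ℚₚ) (x-int : ∣ x ∣≤p^- 0) where

    scale-term : ∀ i → ((ι (c i) * a ^ e i) * x ^ e i) ≈ (ι (c i) * (a * x) ^ e i)
    scale-term i = R.trans (R.*-assoc (ι (c i)) (a ^ e i) (x ^ e i))
      (R.*-congˡ (R.sym (^R.^-distrib-* a x (e i))))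

    scale-converges : Converges (partialSum λ i → ι (c i) * a ^ e i) →
                      Converges (partialSum λ i → ι (c i) * (a * x) ^ e i)
    scale-converges h = null-converges (λ i → ι (c i) * (a * x) ^ e i) λ k →
      let N , g = terms-null (λ i → ι (c i) * a ^ e i) h k in N , λ {n} N≤n →
        ≈⇒ball (scale-term n) (Ball-* (g N≤n) (^-ball x (e n) x-int))

  ----------------------------------------------------------------------
  -- sin, cos, tan

  cosCoeff sinCoeff : ℕ → ℚ
  cosCoeff i = ((ℤ.-1ℤ ℤ.^ i) / (2 ℕ.* i) !) {{(2 ℕ.* i) ℕ.!≢0}}
  sinCoeff i = ((ℤ.-1ℤ ℤ.^ i) / (1 ℕ.+ 2 ℕ.* i) !) {{(1 ℕ.+ 2 ℕ.* i) ℕ.!≢0}}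

  cosTerm sinTerm : ℚₚ → ℕ → ℚₚ
  cosTerm x i = ι (cosCoeff i) * x ^ (2 ℕ.* i)
  sinTerm x i = ι (sinCoeff i) * x ^ (1 ℕ.+ 2 ℕ.* i)

  -- The points of ℚₚ at which sin and cos are defined.  For odd p this is pℤₚ;
  -- at units of ℤₚ the series diverge.
  record Dom : Set where
    constructor mkDom
    field
      point        : ℚₚ
      cosConverges : Converges (partialSum (cosTerm point))
      sinConverges : Converges (partialSum (sinTerm point))

  open Dom public

  -- Limits are unique up to _≈_, so the choice of convergence witness in Dom
  -- does not matter.
  cos sin : Dom → ℚₚ
  cos x = proj₁ (cosConverges x)
  sin x = proj₁ (sinConverges x)

  tan : (x : Dom) → Invertible (cos x) → ℚₚ
  tan x u = sin x ÷ cos x ⟨ u ⟩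

  -- vₚ(n!) ≤ n/2 for p ≥ 3
  !-block : ∀ q r → r ℕ.< p → ∃[ w ] ¬ (p ∣ w) × (r ℕ.+ q ℕ.* p) ! ≡ p ℕ.^ q ℕ.* q ! ℕ.* w
  !-block zero    zero    _   = 1 , p∤1 , refl
  !-block (suc q) zero    _   =
    let instance _ = prime⇒nonZero p-prime
        w , p∤w , e = !-block q (ℕ.pred p) (ℕ.≤-reflexive (ℕ.suc-pred p))
    in w , p∤w , (begin
      (suc q ℕ.* p) !                                   ≡⟨ cong (λ z → (z ℕ.+ q ℕ.* p) !) (ℕ.suc-pred p) ⟨
      suc (ℕ.pred p ℕ.+ q ℕ.* p) ℕ.* (ℕ.pred p ℕ.+ q ℕ.* p) !
        ≡⟨ cong₂ ℕ._*_ (cong (ℕ._+ q ℕ.* p) (ℕ.suc-pred p)) e ⟩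
      suc q ℕ.* p ℕ.* (p ℕ.^ q ℕ.* q ! ℕ.* w)
        ≡⟨ solve 5 (λ a b c d w → a :* b :* (c :* d :* w) := b :* c :* (a :* d) :* w) refl
             (suc q) p (p ℕ.^ q) (q !) w ⟩
      p ℕ.^ suc q ℕ.* (suc q) ! ℕ.* w                   ∎)
    where
    open ≡-Reasoning
    open ℕ-Solver
  !-block q       (suc r) r<p =
    let w , p∤w , e = !-block q r (ℕ.<-trans (ℕ.n<1+n r) r<p)
        s = suc (r ℕ.+ q ℕ.* p)
    in s ℕ.* w , ∤-* (p∤s r<p) p∤w ,
       trans (cong (s ℕ.*_) e)
         (solve 3 (λ s a w → s :* (a :* w) := a :* (s :* w)) refl s (p ℕ.^ q ℕ.* q !) w)
    where
    open ℕ-Solver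
    p∤s : suc r ℕ.< p → ¬ (p ∣ suc r ℕ.+ q ℕ.* p)
    p∤s r<p p∣s = ℕ.<⇒≱ r<p (∣⇒≤ (∣m+n∣m⇒∣n (subst (p ∣_) (ℕ.+-comm (suc r) (q ℕ.* p)) p∣s) (n∣m*n q)))

  !-valuation : 3 ≤ p → ∀ n → ∃[ e ] ∃[ u ] ¬ (p ∣ u) × n ! ≡ p ℕ.^ e ℕ.* u × 2 ℕ.* e ≤ n
  !-valuation 3≤p n = go n (<-wellFounded n)
    where
    instance
      _ = prime⇒nonZero p-prime
    go : ∀ n → Acc ℕ._<_ n → ∃[ e ] ∃[ u ] ¬ (p ∣ u) × n ! ≡ p ℕ.^ e ℕ.* u × 2 ℕ.* e ≤ n
    go zero        _         = 0 , 1 , p∤1 , refl , ℕ.z≤n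
    go n@(suc n-1) (acc rec) =
      let q = n DivMod./ p
          r = n DivMod.% p
          n≡ = DivMod.m≡m%n+[m/n]*n n p
          w , p∤w , f = !-block q r (DivMod.m%n<n n p)
          e , u , p∤u , g , 2e≤q = go q (rec (DivMod.m/n<m n p (ℕ.≤-trans (ℕ.n≤1+n 2) 3≤p)))
      in q ℕ.+ e , u ℕ.* w , ∤-* p∤u p∤w ,
         (begin
           n !                                          ≡⟨ cong _! n≡ ⟩
           (r ℕ.+ q ℕ.* p) !                            ≡⟨ f ⟩
           p ℕ.^ q ℕ.* q ! ℕ.* w                        ≡⟨ cong (λ z → p ℕ.^ q ℕ.* z ℕ.* w) g ⟩
           p ℕ.^ q ℕ.* (p ℕ.^ e ℕ.* u) ℕ.* w
             ≡⟨ solve 4 (λ a b u w → a :* (b :* u) :* w := a :* b :* (u :* w)) refl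
                  (p ℕ.^ q) (p ℕ.^ e) u w ⟩
           p ℕ.^ q ℕ.* p ℕ.^ e ℕ.* (u ℕ.* w)            ≡⟨ cong (ℕ._* (u ℕ.* w)) (ℕ.^-distribˡ-+-* p q e) ⟨
           p ℕ.^ (q ℕ.+ e) ℕ.* (u ℕ.* w)                ∎) ,
         (≤R.begin
           2 ℕ.* (q ℕ.+ e)         ≤R.≡⟨ ℕ.*-distribˡ-+ 2 q e ⟩
           2 ℕ.* q ℕ.+ 2 ℕ.* e     ≤R.≤⟨ ℕ.+-monoʳ-≤ (2 ℕ.* q) 2e≤q ⟩
           2 ℕ.* q ℕ.+ q           ≤R.≡⟨ solve 1 (λ q → con 2 :* q :+ q := q :* con 3) refl q ⟩
           q ℕ.* 3                 ≤R.≤⟨ ℕ.*-monoʳ-≤ q 3≤p ⟩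
           q ℕ.* p                 ≤R.≤⟨ ℕ.m≤n+m (q ℕ.* p) r ⟩
           r ℕ.+ q ℕ.* p           ≤R.≡⟨ n≡ ⟨
           n                       ≤R.∎)
      where
      open ≡-Reasoning
      module ≤R = ℕ.≤-Reasoning
      open ℕ-Solver

  ^-ball-p : ∀ x → ∣ x ∣≤p^- 1 → ∀ n → ∣ x ^ n ∣≤p^- n
  ^-ball-p x h zero    = ι-integral p∤1
  ^-ball-p x (eventually N h) (suc n) =
    let eventually M g = ^-ball-p x (eventually N h) n in eventually (N ⊔ M) λ l →
    let ball u hu e = h (⊔ˡ l)
        ball v hv f = g (⊔ʳ {N} l)
    in ball (u ℚ.* v) (*-integral u v hu hv)
       (trans (cong₂ ℚ._*_ e f)
         (solve 4 (λ P Q u v → (P :* con 1ℚ :* u) :* (Q :* v) := (P :* Q) :* (u :* v)) refl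
            pℚ (pℚ ^ᵠ n) u v))
    where open +-*-Solver

  term-ball : 3 ≤ p → ∀ x → ∣ x ∣≤p^- 1 → ∀ i n k → 2 ℕ.* k ≤ n →
              ∣ ι ((i / n !) {{n ℕ.!≢0}}) * x ^ n ∣≤p^- k
  term-ball 3≤p x h i n k 2k≤n =
    let instance _ = n ℕ.!≢0
        e , u , p∤u , n!≡ , 2e≤n = !-valuation 3≤p n
        k+e≤n = ℕ.*-cancelˡ-≤ 2 (≤R.begin
          2 ℕ.* (k ℕ.+ e)         ≤R.≡⟨ ℕ.*-distribˡ-+ 2 k e ⟩
          2 ℕ.* k ℕ.+ 2 ℕ.* e     ≤R.≤⟨ ℕ.+-mono-≤ 2k≤n 2e≤n ⟩
          n ℕ.+ n                 ≤R.≡⟨ cong (n ℕ.+_) (ℕ.+-identityʳ n) ⟨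
          2 ℕ.* n                 ≤R.∎)
        eventually N g = Ball-weaken k+e≤n (^-ball-p x h n)
    in eventually N λ l → ball-* {e} {k} (pᵏ*/-integral e i (n !) u p∤u n!≡) (g l)
    where module ≤R = ℕ.≤-Reasoning

  pℤₚ⊆Dom : ¬ (2 ∣ p) → ∀ x → ∣ x ∣≤p^- 1 → Dom
  pℤₚ⊆Dom p-odd x h = mkDom x
    (null-converges (cosTerm x) λ k → k , λ {i} k≤i →
      term-ball 3≤p x h (ℤ.-1ℤ ℤ.^ i) (2 ℕ.* i) k (ℕ.*-monoʳ-≤ 2 k≤i))
    (null-converges (sinTerm x) λ k → k , λ {i} k≤i →
      term-ball 3≤p x h (ℤ.-1ℤ ℤ.^ i) (1 ℕ.+ 2 ℕ.* i) k
        (ℕ.m≤n⇒m≤1+n (ℕ.*-monoʳ-≤ 2 k≤i)))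
    where
    3≤p : 3 ≤ p
    3≤p = ℕ.≤∧≢⇒< (ℕ.nonTrivial⇒n>1 p {{prime⇒nonTrivial p-prime}})
                   λ 2≡p → p-odd (subst (2 ∣_) 2≡p ∣-refl)

  -- A series converging at a also converges at a x for x ∈ ℤₚ.
  infixl 7 _·_
  _·_ : Dom → ℤₚ → Dom
  a · x = mkDom (point a * value x)
    (scale-converges cosCoeff (2 ℕ.*_) (point a) (value x) (integral x) (cosConverges a))
    (scale-converges sinCoeff (λ i → 1 ℕ.+ 2 ℕ.* i) (point a) (value x) (integral x) (sinConverges a))

  ----------------------------------------------------------------------
  -- The fermionic integral

  -- The difference quotients (f x - f y)/(x - y) tend to l as (x , y) → (c , c).
  -- The inequality ∣ f x - f y - l (x - y) ∣ ≤ p⁻ᵏ ∣ x - y ∣ is expressed by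
  -- quantifying over all upper bounds p⁻ʲ of ∣ x - y ∣.
  StrictDerivativeAt : (ℤₚ → ℚₚ) → ℤₚ → ℚₚ → Set
  StrictDerivativeAt f c l = ∀ k → ∃[ m ] ∀ x y →
    ∣ value x - value c ∣≤p^- m → ∣ value y - value c ∣≤p^- m →
    ∀ j → ∣ value x - value y ∣≤p^- j →
    ∣ (f x - f y) - l * (value x - value y) ∣≤p^- (k ℕ.+ j)

  StrictlyDifferentiable : (ℤₚ → ℚₚ) → Set
  StrictlyDifferentiable f = ∀ c → ∃[ l ] StrictDerivativeAt f c l

  fermionicSum : (ℤₚ → ℚₚ) → ℕ → ℚₚ
  fermionicSum f N = partialSum (λ x → f (fromℕ x) * (- 1#) ^ x) (p ℕ.^ N)

  infix 4 ∫_dμ₋₁≈_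
  record ∫_dμ₋₁≈_ (f : ℤₚ → ℚₚ) (I : ℚₚ) : Set where
    field
      strictlyDifferentiable : StrictlyDifferentiable f
      limit                  : fermionicSum f ⟶ I

{-# OPTIONS --safe #-}

-- Convergence of the cosine series at a ∈ ℤₚ forces p ∣ a, and on pℤₚ Cauchy products of the
-- series give the addition formulas.  With t = a/2,
--   2 cos t · cos (ax) = cos (ax - t) + cos (ax + t)  and  2 cos t · sin (ax) = sin (ax - t) + sin (ax + t),
-- so the alternating sums over x < pᴺ telescope (pᴺ is odd) to cos t + cos (a pᴺ - t) and
-- - sin t + sin (a pᴺ - t), which tend to 2 cos t and - 2 sin t.  As cos t ≡ 1 mod p it is invertible,
-- and the integrals are 1 and - tan t.

module Submission where

open import Defs
open import Algebra.Bundles using (CommutativeRing)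
import Algebra.Properties.CommutativeSemiring.Binomial as Binomial
import Algebra.Properties.Semiring.Mult as Mult
import Algebra.Properties.Semiring.Sum as SemiringSum
import Algebra.Solver.Ring
open import Algebra.Solver.Ring.AlmostCommutativeRing using (fromCommutativeRing; _-Raw-AlmostCommutative⟶_)
open import Data.Fin.Base using (Fin; toℕ)
import Data.Fin.Properties as Fin
open import Data.Integer.Base as ℤ using (ℤ; +_)
import Data.Integer.Divisibility.Signed as ℤ
import Data.Integer.Properties as ℤ
open import Data.Integer.Solver using () renaming (module +-*-Solver to ℤ-Solver)
open import Data.Maybe.Base using (Maybe; map)
open import Data.Nat.Base as ℕ using (ℕ; zero; suc; _≤_; _⊔_; z≤n; s≤s; _!; NonZero; _∸_)
open import Data.Nat.Combinatorics using (nCk≡n!/k![n-k]!; k![n∸k]!∣n!) renaming (_C_ to _choose_)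
open import Data.Nat.DivMod using (_%_; m%n<n; m≡m%n+[m/n]*n; m/n*n≡m)
open import Data.Nat.Divisibility using (_∣_; divides; ∣-refl; ∣-trans; m∣m*n; m%n≡0⇒n∣m; m≤n⇒m!∣n!)
open import Data.Nat.Primality using (Prime; euclidsLemma; prime⇒nonTrivial; prime⇒nonZero)
import Data.Nat.Properties as ℕ
open import Data.Nat.Solver renaming (module +-*-Solver to ℕ-Solver)
open import Data.Product.Base using (_×_; Σ-syntax; ∃-syntax; _,_; proj₁; proj₂)
open import Data.Rational.Base as ℚ using (ℚ; 0ℚ; 1ℚ; ½; _/_; ↥_; ↧_; ↧ₙ_)
import Data.Rational.Properties as ℚ
open import Data.Rational.Solver using (module +-*-Solver)
open import Data.Rational.Unnormalised.Base as ℚᵘ using (*≡*; mkℚᵘ)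
import Data.Rational.Unnormalised.Properties as ℚᵘ
open import Data.Sum.Base as Sum using (_⊎_; [_,_]′)
open import Function.Base using (_∘_; id)
open import Relation.Binary.PropositionalEquality
  using (_≡_; refl; sym; trans; cong; cong₂; subst; module ≡-Reasoning)
open import Relation.Nullary using (¬_; contradiction)
open import Relation.Nullary.Decidable using (dec⇒maybe)

-- One estimate carries the analysis: since `2 v(n!) ≤ n` for odd `p`, `x ∈ p^(u+1) ℤₚ` gives
-- `x^n / n! ∈ p^(2u+1) ℤₚ` for all `n ≥ 2`. Hence `cos x - 1` and `sin x - x` are of second order,
-- with one power of `p` to spare. The second order yields strict differentiability by way of the
-- addition formulas; the spare power makes `cos t` a unit even when `p` divides `a` only once. Both
-- addition formulas come from a single computation with series `Σ c n x^n / n!`: when `c` is the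
-- real or the imaginary part of `i^n`, the rule `i^(j+k) = i^j i^k` becomes the formula for
-- `cos (x + y)` or `sin (x + y)`.

module PadicTrigonometry (p : ℕ) (p-prime : Prime p) (p-odd : ¬ (2 ∣ p)) where
  open Padic p p-prime
  open ℚ-Exp using () renaming (_^_ to _^ᵠ_)

  -- Balls and limits in ℚₚ

  ι-+ : ∀ a b → ι (a ℚ.+ b) ≈ (ι a + ι b)
  ι-+ a b = pointwise (ι (a ℚ.+ b)) (ι a + ι b) λ _ → refl

  ι-* : ∀ a b → ι (a ℚ.* b) ≈ (ι a * ι b)
  ι-* a b = pointwise (ι (a ℚ.* b)) (ι a * ι b) λ _ → refl

  ι-neg : ∀ a → ι (ℚ.- a) ≈ (- ι a)
  ι-neg a = pointwise (ι (ℚ.- a)) (- ι a) λ _ → refl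

  ι-≟ : ∀ a b → Maybe (ι a ≈ ι b)
  ι-≟ a b = map (λ a≡b → R.reflexive (cong ι a≡b)) (dec⇒maybe (a ℚ.≟ b))

  -- The coefficients are rationals, embedded by `ι`, so that identities may contain `con ½` and
  -- normal forms are compared by deciding equality in ℚ.
  module ℚₚ-Solver = Algebra.Solver.Ring
    (CommutativeRing.rawRing ℚ.+-*-commutativeRing) (fromCommutativeRing ℚₚ-commutativeRing)
    (_-Raw-AlmostCommutative⟶_.constructor ι ι-+ ι-* ι-neg R.refl R.refl) ι-≟

  module ≈-R where
    open import Relation.Binary.Reasoning.Setoid R.setoid public

  Ball-0 : ∀ k → ∣ 0# ∣≤p^- k
  Ball-0 k = eventually 0 λ _ → ball-0 k

  Ball-*-+ : ∀ {k l x y} → ∣ x ∣≤p^- k → ∣ y ∣≤p^- l → ∣ x * y ∣≤p^- (k ℕ.+ l)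
  Ball-*-+ {k} {l} (eventually N h) (eventually M g) = eventually (N ⊔ M) λ n≥ →
    let ball u hu e = h (⊔ˡ n≥)
        ball v hv f = g (⊔ʳ {N} n≥)
    in ball (u ℚ.* v) (*-integral u v hu hv)
         (trans (cong₂ ℚ._*_ e f)
         (trans (solve 4 (λ P Q u v → (P :* u) :* (Q :* v) := (P :* Q) :* (u :* v)) refl
                   (pℚ ^ᵠ k) (pℚ ^ᵠ l) u v)
                (cong (ℚ._* (u ℚ.* v)) (sym (ℚ-Exp.^-homo-* pℚ k l)))))
    where open +-*-Solver

  -- `x` may have a pole of order `b`, so `y` has to be closer to 0 by `b` further powers of `p`.
  -- This lets limits be multiplied by arbitrary constants, such as inverses.
  Ball-*ˡ : ∀ x → ∃[ b ] ∀ {k y} → ∣ y ∣≤p^- (k ℕ.+ b) → ∣ x * y ∣≤p^- k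
  Ball-*ˡ x =
    let b , B , i = eventually-bounded x
    in b , λ { {k} (eventually N h) → eventually (B ⊔ N) λ n≥ →
         ball-* {b} {k} (i (⊔ˡ n≥)) (h (⊔ʳ {B} n≥)) }

  Ball-sum : ∀ {k} t → (∀ i → ∣ t i ∣≤p^- k) → ∀ n → ∣ partialSum t n ∣≤p^- k
  Ball-sum {k} t h zero    = Ball-0 k
  Ball-sum     t h (suc n) = Ball-+ (h 0) (Ball-sum (t ∘ suc) (h ∘ suc) n)

  partialSum-cong : ∀ {t u} → (∀ i → t i ≈ u i) → ∀ n → partialSum t n ≈ partialSum u n
  partialSum-cong h n = ΣR.sum-cong-≋ {n} λ i → h (toℕ i)

  x-0≈x : ∀ x → (x - 0#) ≈ x
  x-0≈x = solve 1 (λ x → x :- con 0ℚ := x) R.refl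
    where open ℚₚ-Solver

  ⟶-cong : ∀ {s s′ l l′} → (∀ n → s n ≈ s′ n) → l ≈ l′ → s ⟶ l → s′ ⟶ l′
  ⟶-cong e f h k =
    let N , g = h k
    in N , λ {n} n≥ → ≈⇒ball (R.+-cong (e n) (R.-‿cong f)) (g n≥)

  -- A single late term of `s` lies within `p⁻ᵏ` of both `l` and `z`, and the ultrametric inequality
  -- does not enlarge the radius.
  ⟶-ball : ∀ {s l k} z → s ⟶ l → (∃[ N ] ∀ {n} → N ≤ n → ∣ s n - z ∣≤p^- k) → ∣ l - z ∣≤p^- k
  ⟶-ball {s} {k = k} z h (M , g) =
    let N , f = h k
    in ball-trans {y = s (N ⊔ M)} (ball-sym (f (ℕ.m≤m⊔n N M))) (g (ℕ.m≤n⊔m N M))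

  ⟶-unique : ∀ {s l m} → s ⟶ l → s ⟶ m → l ≈ m
  ⟶-unique {m = m} h g = mk≈ λ k → ⟶-ball m h (g k)

  ⟶-+ : ∀ {s t l m} → s ⟶ l → t ⟶ m → (λ n → s n + t n) ⟶ (l + m)
  ⟶-+ {s} {t} {l} {m} h g k =
    let N , h′ = h k
        M , g′ = g k
    in N ⊔ M , λ {n} n≥ → ≈⇒ball
         (solve 4 (λ a b c d → (a :- b) :+ (c :- d) := (a :+ c) :- (b :+ d)) R.refl (s n) l (t n) m)
         (Ball-+ (h′ (⊔ˡ n≥)) (g′ (⊔ʳ {N} n≥)))
    where open ℚₚ-Solver

  -- Cauchy products

  -- Recursion shifts `t` and leaves the sequence `u` fixed, as it does in `triangle`, so the two
  -- can be compared row by row.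
  conv : (ℕ → ℚₚ) → (ℕ → ℚₚ) → ℕ → ℚₚ
  conv t u zero    = t 0 * u 0
  conv t u (suc n) = t 0 * u (suc n) + conv (t ∘ suc) u n

  -- Σ_{j<N} t_j U_{N-j}, where U is the sequence of partial sums of u
  triangle : (ℕ → ℚₚ) → (ℕ → ℚₚ) → ℕ → ℚₚ
  triangle t u zero    = 0#
  triangle t u (suc n) = t 0 * partialSum u (suc n) + triangle (t ∘ suc) u n

  -- Each row `t_j U_{n-j}` grows by the entry `t_j u_{n-j}`, and these entries form the
  -- antidiagonal `conv t u n`.
  triangle-suc : ∀ t u n → triangle t u (suc n) ≈ (triangle t u n + conv t u n)
  triangle-suc t u zero    =
    solve 2 (λ a b → a :* (b :+ con 0ℚ) :+ con 0ℚ := con 0ℚ :+ a :* b) R.refl (t 0) (u 0)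
    where open ℚₚ-Solver
  triangle-suc t u (suc n) = R.trans
    (R.+-cong (R.*-congˡ (partialSum-suc u (suc n))) (triangle-suc (t ∘ suc) u n))
    (solve 5 (λ a b c d e → a :* (b :+ c) :+ (d :+ e) := (a :* b :+ d) :+ (a :* c :+ e)) R.refl
      (t 0) (partialSum u (suc n)) (u (suc n)) (triangle (t ∘ suc) u n) (conv (t ∘ suc) u n))
    where open ℚₚ-Solver

  partialSum-conv : ∀ t u n → partialSum (conv t u) n ≈ triangle t u n
  partialSum-conv t u zero    = R.refl
  partialSum-conv t u (suc n) = R.trans (partialSum-suc (conv t u) n)
    (R.trans (R.+-congʳ (partialSum-conv t u n)) (R.sym (triangle-suc t u n)))

  triangle-step : ∀ {k} a b x y L → ∣ a * (x - L) ∣≤p^- k → ∣ b - y * L ∣≤p^- k →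
                  ∣ (a * x + b) - (a + y) * L ∣≤p^- k
  triangle-step a b x y L h g = ≈⇒ball
    (solve 5 (λ a b x y L → a :* (x :- L) :+ (b :- y :* L) := (a :* x :+ b) :- (a :+ y) :* L) R.refl
      a b x y L)
    (Ball-+ h g)
    where open ℚₚ-Solver

  triangle-ball : ∀ {k} t u L → (∀ j → ∣ t j ∣≤p^- k) → (∀ n → ∣ partialSum u n - L ∣≤p^- 0) →
                  ∀ n → ∣ triangle t u n - partialSum t n * L ∣≤p^- k
  triangle-ball {k} t u L t-ball u-ball zero    = ≈⇒ball
    (solve 1 (λ L → con 0ℚ := con 0ℚ :- con 0ℚ :* L) R.refl L) (Ball-0 k)
    where open ℚₚ-Solver
  triangle-ball     t u L t-ball u-ball (suc n) = triangle-step _ _ _ _ L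
    (Ball-* (t-ball 0) (u-ball (suc n)))
    (triangle-ball (t ∘ suc) u L (t-ball ∘ suc) u-ball n)

  -- The difference is `Σ_{j<n} t_j (U_{n-j} - L)`. For `j < J` the second factor is small, as
  -- `n - j ≥ M`; from `J` on the first factor is. The recursion peels off the first `J` rows, and
  -- the ultrametric inequality takes the place of a bound on the sum of absolute values.
  triangle-close : ∀ {k} t u L J M →
    (∀ j → ∣ t j ∣≤p^- 0) → (∀ n → ∣ partialSum u n - L ∣≤p^- 0) →
    (∀ {j} → J ≤ j → ∣ t j ∣≤p^- k) → (∀ {n} → M ≤ n → ∣ partialSum u n - L ∣≤p^- k) →
    ∀ {n} → J ℕ.+ M ≤ n → ∣ triangle t u n - partialSum t n * L ∣≤p^- k
  triangle-close t u L zero M t₀ u₀ t-null u-lim {n} _ =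
    triangle-ball t u L (λ _ → t-null z≤n) u₀ n
  triangle-close t u L (suc J) M t₀ u₀ t-null u-lim {suc n} (s≤s n≥) = triangle-step _ _ _ _ L
    (≈⇒ball (R.*-comm _ _)
      (Ball-* (u-lim (ℕ.≤-trans (ℕ.m≤n+m M J) (ℕ.m≤n⇒m≤1+n n≥))) (t₀ 0)))
    (triangle-close (t ∘ suc) u L J M (t₀ ∘ suc) u₀ (t-null ∘ s≤s) u-lim n≥)

  limit-integral : ∀ {k s l} → s ⟶ l → (∀ n → ∣ s n ∣≤p^- k) → ∣ l ∣≤p^- k
  limit-integral {l = l} s⟶l s-ball = ≈⇒ball (x-0≈x l)
    (⟶-ball 0# s⟶l (0 , λ {n} _ → ≈⇒ball (R.sym (x-0≈x _)) (s-ball n)))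

  cauchy-product : ∀ {t u T U} → (∀ j → ∣ t j ∣≤p^- 0) → (∀ j → ∣ u j ∣≤p^- 0) →
                   partialSum t ⟶ T → partialSum u ⟶ U → partialSum (conv t u) ⟶ (T * U)
  cauchy-product {t} {u} {T} {U} t₀ u₀ t⟶T u⟶U k =
    let J , t-null = terms-null t (T , t⟶T) k
        M , u-lim = u⟶U k
        N , t-lim = t⟶T k
        U₀ = limit-integral u⟶U (Ball-sum u u₀)
        u-U₀ = λ n → Ball-+ (Ball-sum u u₀ n) (Ball-neg U₀)
    in (J ℕ.+ M) ⊔ N , λ {n} n≥ → ≈⇒ball (R.+-congʳ (R.sym (partialSum-conv t u n)))
         (ball-trans (triangle-close t u U J M t₀ u-U₀ t-null u-lim (⊔ˡ n≥))
           (≈⇒ball (solve 3 (λ a b c → (a :- b) :* c := a :* c :- b :* c) R.refl (partialSum t n) T U)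
             (Ball-* (t-lim (⊔ʳ {J ℕ.+ M} n≥)) U₀)))
    where open ℚₚ-Solver

  /-* : ∀ i j m n .{{_ : NonZero m}} .{{_ : NonZero n}} .{{_ : NonZero (m ℕ.* n)}} →
        (i ℤ.* j) / (m ℕ.* n) ≡ (i / m) ℚ.* (j / n)
  /-* i j (suc m) (suc n) = ℚ.toℚᵘ-injective
    (ℚᵘ.≃-trans (ℚ.toℚᵘ-fromℚᵘ (mkℚᵘ (i ℤ.* j) _))
    (ℚᵘ.≃-trans (ℚᵘ.≃-sym (ℚᵘ.*-cong (ℚ.toℚᵘ-fromℚᵘ (mkℚᵘ i m)) (ℚ.toℚᵘ-fromℚᵘ (mkℚᵘ j n))))
                (ℚᵘ.≃-sym (ℚ.toℚᵘ-homo-* (i / suc m) (j / suc n)))))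

  /-+ : ∀ i j n .{{_ : NonZero n}} → (i ℤ.+ j) / n ≡ i / n ℚ.+ j / n
  /-+ i j (suc n) = ℚ.toℚᵘ-injective
    (ℚᵘ.≃-trans (ℚ.toℚᵘ-fromℚᵘ (mkℚᵘ (i ℤ.+ j) n))
    (ℚᵘ.≃-trans (*≡* (solve 3 (λ i j n → (i :+ j) :* (n :* n) := (i :* n :+ j :* n) :* n) refl
                        i j (+ suc n)))
    (ℚᵘ.≃-trans (ℚᵘ.≃-sym (ℚᵘ.+-cong (ℚ.toℚᵘ-fromℚᵘ (mkℚᵘ i n)) (ℚ.toℚᵘ-fromℚᵘ (mkℚᵘ j n))))
                (ℚᵘ.≃-sym (ℚ.toℚᵘ-homo-+ (i / suc n) (j / suc n))))))
    where open ℤ-Solver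

  -- Exponential power series

  infixl 7 _/!_
  _/!_ : ℤ → ℕ → ℚ
  i /! n = (i / n !) {{n ℕ.!≢0}}

  powerTerm : (ℕ → ℤ) → ℚₚ → ℕ → ℚₚ
  powerTerm c x n = ι (c n /! n) * x ^ n

  choose-/! : ∀ {k n} i → k ≤ n →
              (+ (n choose k) / 1) ℚ.* (i /! n) ≡ (i / (k ! ℕ.* (n ∸ k) !)) {{k ℕ.!* (n ∸ k) !≢0}}
  choose-/! {k} {n} i k≤n = /-cancel (n choose k) i (k ! ℕ.* (n ∸ k) !) (n !)
    (sym (trans (cong (ℕ._* (k ! ℕ.* (n ∸ k) !)) (nCk≡n!/k![n-k]! k≤n)) (m/n*n≡m (k![n∸k]!∣n! k≤n))))
    where
    instance
      _ = k ℕ.!* (n ∸ k) !≢0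
      _ = n ℕ.!≢0

  module ×R = Mult R.semiring
  module ∑R = SemiringSum R.semiring
  module BinomialR = Binomial R.commutativeSemiring

  ×-ι : ∀ n x → (n ×R.× x) ≈ (ι (+ n / 1) * x)
  ×-ι zero    x = R.sym (R.zeroˡ x)
  ×-ι (suc n) x = begin
    x + n ×R.× x                       ≈⟨ R.+-congˡ (×-ι n x) ⟩
    x + ι (+ n / 1) * x
      ≈⟨ solve 2 (λ x c → x :+ c :* x := (con 1ℚ :+ c) :* x) R.refl x (ι (+ n / 1)) ⟩
    (ι 1ℚ + ι (+ n / 1)) * x           ≈⟨ R.*-congʳ (ι-+ 1ℚ (+ n / 1)) ⟨
    ι (1ℚ ℚ.+ + n / 1) * x             ≡⟨ cong (λ q → ι q * x) (/-+ (+ 1) (+ n) 1) ⟨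
    ι (+ suc n / 1) * x                ∎
    where
    open ≈-R
    open ℚₚ-Solver

  conv-sum : ∀ t u n → conv t u n ≈ sum {suc n} λ k → t (toℕ k) * u (n ∸ toℕ k)
  conv-sum t u zero    = R.sym (R.+-identityʳ (t 0 * u 0))
  conv-sum t u (suc n) = R.+-congˡ (conv-sum (t ∘ suc) u n)

  -- The common shape of the rules for the real and the imaginary part of `i^(j+k)`. Since
  -- `(n choose k) / n! = 1 / (k! (n-k)!)`, such a rule splits the binomial expansion of
  -- `c n (x + y)^n / n!` into two Cauchy products.
  module _ (c c₁ d₁ c₂ d₂ : ℕ → ℤ)
           (c-+ : ∀ j k → c (j ℕ.+ k) ≡ c₁ j ℤ.* d₁ k ℤ.+ c₂ j ℤ.* d₂ k) where

    split-coeff : ∀ {k n} → k ≤ n → (+ (n choose k) / 1) ℚ.* (c n /! n) ≡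
                  (c₁ k /! k) ℚ.* (d₁ (n ∸ k) /! (n ∸ k)) ℚ.+ (c₂ k /! k) ℚ.* (d₂ (n ∸ k) /! (n ∸ k))
    split-coeff {k} {n} k≤n = trans (choose-/! (c n) k≤n)
      (trans (cong (_/ (k ! ℕ.* (n ∸ k) !)) (trans (cong c (sym (ℕ.m+[n∸m]≡n k≤n))) (c-+ k (n ∸ k))))
      (trans (/-+ (c₁ k ℤ.* d₁ (n ∸ k)) (c₂ k ℤ.* d₂ (n ∸ k)) (k ! ℕ.* (n ∸ k) !))
             (cong₂ ℚ._+_ (/-* (c₁ k) (d₁ (n ∸ k)) (k !) ((n ∸ k) !)) (/-* (c₂ k) (d₂ (n ∸ k)) (k !) ((n ∸ k) !)))))
      where
      instance
        _ = k ℕ.!* (n ∸ k) !≢0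
        _ = k ℕ.!≢0
        _ = (n ∸ k) ℕ.!≢0

    split-term : ∀ x y n k → k ≤ n →
      (ι (c n /! n) * ((n choose k) ×R.× (x ^ k * y ^ (n ∸ k)))) ≈
      (powerTerm c₁ x k * powerTerm d₁ y (n ∸ k) + powerTerm c₂ x k * powerTerm d₂ y (n ∸ k))
    split-term x y n k k≤n = begin
      ι (c n /! n) * ((n choose k) ×R.× (x ^ k * y ^ j))
        ≈⟨ R.*-congˡ (×-ι (n choose k) (x ^ k * y ^ j)) ⟩
      ι (c n /! n) * (ι (+ (n choose k) / 1) * (x ^ k * y ^ j))
        ≈⟨ solve 3 (λ a b z → a :* (b :* z) := (b :* a) :* z) R.refl
             (ι (c n /! n)) (ι (+ (n choose k) / 1)) (x ^ k * y ^ j) ⟩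
      (ι (+ (n choose k) / 1) * ι (c n /! n)) * (x ^ k * y ^ j)
        ≈⟨ R.*-congʳ (ι-* (+ (n choose k) / 1) (c n /! n)) ⟨
      ι ((+ (n choose k) / 1) ℚ.* (c n /! n)) * (x ^ k * y ^ j)
        ≡⟨ cong (λ q → ι q * (x ^ k * y ^ j)) (split-coeff k≤n) ⟩
      ι ((c₁ k /! k) ℚ.* (d₁ j /! j) ℚ.+ (c₂ k /! k) ℚ.* (d₂ j /! j)) * (x ^ k * y ^ j)
        ≈⟨ R.*-congʳ (R.trans (ι-+ ((c₁ k /! k) ℚ.* (d₁ j /! j)) ((c₂ k /! k) ℚ.* (d₂ j /! j)))
             (R.+-cong (ι-* (c₁ k /! k) (d₁ j /! j)) (ι-* (c₂ k /! k) (d₂ j /! j)))) ⟩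
      (ι (c₁ k /! k) * ι (d₁ j /! j) + ι (c₂ k /! k) * ι (d₂ j /! j)) * (x ^ k * y ^ j)
        ≈⟨ solve 6 (λ a b c d X Y → (a :* b :+ c :* d) :* (X :* Y) :=
                      (a :* X) :* (b :* Y) :+ (c :* X) :* (d :* Y)) R.refl
             (ι (c₁ k /! k)) (ι (d₁ j /! j)) (ι (c₂ k /! k)) (ι (d₂ j /! j)) (x ^ k) (y ^ j) ⟩
      powerTerm c₁ x k * powerTerm d₁ y j + powerTerm c₂ x k * powerTerm d₂ y j ∎
      where
      j = n ∸ k
      open ≈-R
      open ℚₚ-Solver

    powerTerm-+ : ∀ x y n → powerTerm c (x + y) n ≈
      (conv (powerTerm c₁ x) (powerTerm d₁ y) n + conv (powerTerm c₂ x) (powerTerm d₂ y) n)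
    powerTerm-+ x y n = begin
      ι (c n /! n) * (x + y) ^ n
        ≈⟨ R.*-congˡ (BinomialR.theorem n x y) ⟩
      ι (c n /! n) * BinomialR.binomialExpansion x y n
        ≈⟨ ∑R.*-distribˡ-sum {suc n} (ι (c n /! n)) (BinomialR.binomialTerm x y n) ⟩
      sum {suc n} (λ k → ι (c n /! n) * BinomialR.binomialTerm x y n k)
        ≈⟨ ΣR.sum-cong-≋ {suc n} (λ k → split-term x y n (toℕ k) (Fin.toℕ≤pred[n] k)) ⟩
      sum {suc n} (λ k → t₁ k + t₂ k)
        ≈⟨ ∑R.∑-distrib-+ {suc n} t₁ t₂ ⟩
      sum {suc n} t₁ + sum {suc n} t₂
        ≈⟨ R.+-cong (conv-sum (powerTerm c₁ x) (powerTerm d₁ y) n)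
                    (conv-sum (powerTerm c₂ x) (powerTerm d₂ y) n) ⟨
      conv (powerTerm c₁ x) (powerTerm d₁ y) n + conv (powerTerm c₂ x) (powerTerm d₂ y) n ∎
      where
      t₁ t₂ : Fin (suc n) → ℚₚ
      t₁ k = powerTerm c₁ x (toℕ k) * powerTerm d₁ y (n ∸ toℕ k)
      t₂ k = powerTerm c₂ x (toℕ k) * powerTerm d₂ y (n ∸ toℕ k)
      open ≈-R

  -- iⁿ = re n + i · im n
  re im : ℕ → ℤ
  re zero    = + 1
  re (suc n) = ℤ.- im n
  im zero    = + 0
  im (suc n) = re n

  -- Multiplication by `i` exchanges real and imaginary parts, hence the mutual induction on `j`.
  -- The minus sign sits on the factor `im j` so that the rule has the shape of `c-+`.
  re-+ : ∀ j k → re (j ℕ.+ k) ≡ re j ℤ.* re k ℤ.+ (ℤ.- im j) ℤ.* im k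
  im-+ : ∀ j k → im (j ℕ.+ k) ≡ re j ℤ.* im k ℤ.+ im j ℤ.* re k
  re-+ zero    k = solve 2 (λ a b → a := con (+ 1) :* a :+ (:- con (+ 0)) :* b) refl (re k) (im k)
    where open ℤ-Solver
  re-+ (suc j) k = trans (cong ℤ.-_ (im-+ j k))
    (solve 4 (λ a b c d → :- (a :* b :+ c :* d) := (:- c) :* d :+ (:- a) :* b) refl
      (re j) (im k) (im j) (re k))
    where open ℤ-Solver
  im-+ zero    k = solve 2 (λ a b → b := con (+ 1) :* b :+ con (+ 0) :* a) refl (re k) (im k)
    where open ℤ-Solver
  im-+ (suc j) k = trans (re-+ j k)
    (solve 4 (λ a b c d → a :* b :+ (:- c) :* d := (:- c) :* d :+ a :* b) refl
      (re j) (re k) (im j) (im k))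
    where open ℤ-Solver

  -- Even indices are written `i ℕ.* 2` because `suc i ℕ.* 2` computes to two successors, matching
  -- the period of the recursion; `cosTerm≈` and `sinTerm≈` pass to `2 ℕ.* i`.
  re-even : ∀ i → re (i ℕ.* 2) ≡ ℤ.-1ℤ ℤ.^ i
  re-even zero    = refl
  re-even (suc i) = trans (cong ℤ.-_ (re-even i)) (sym (ℤ.-1*i≡-i (ℤ.-1ℤ ℤ.^ i)))

  im-even : ∀ i → im (i ℕ.* 2) ≡ + 0
  im-even zero    = refl
  im-even (suc i) = cong ℤ.-_ (im-even i)

  /!-zero : ∀ n → (+ 0) /! n ≡ 0ℚ
  /!-zero n = ℚ.0/n≡0 (n !) {{n ℕ.!≢0}}

  powerTerm-zero : ∀ c x n → c n ≡ + 0 → powerTerm c x n ≈ 0#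
  powerTerm-zero c x n cn≡0 = R.trans
    (R.*-congʳ {x ^ n} (R.reflexive (cong ι (trans (cong (_/! n) cn≡0) (/!-zero n))))) (R.zeroˡ (x ^ n))

  cosTerm≈ : ∀ x i → powerTerm re x (i ℕ.* 2) ≈ cosTerm x i
  cosTerm≈ x i = R.reflexive (trans (cong (powerTerm re x) (ℕ.*-comm i 2))
    (cong (λ z → ι (z /! (2 ℕ.* i)) * x ^ (2 ℕ.* i))
      (trans (cong re (ℕ.*-comm 2 i)) (re-even i))))

  sinTerm≈ : ∀ x i → powerTerm im x (suc (i ℕ.* 2)) ≈ sinTerm x i
  sinTerm≈ x i = R.reflexive (trans (cong (λ j → powerTerm im x (suc j)) (ℕ.*-comm i 2))
    (cong (λ z → ι (z /! suc (2 ℕ.* i)) * x ^ suc (2 ℕ.* i))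
      (trans (cong re (ℕ.*-comm 2 i)) (re-even i))))

  partialSum-even : ∀ t i → partialSum t (suc i ℕ.* 2) ≈
                    (partialSum t (i ℕ.* 2) + (t (i ℕ.* 2) + t (suc (i ℕ.* 2))))
  partialSum-even t i = R.trans (partialSum-suc t (suc (i ℕ.* 2)))
    (R.trans (R.+-congʳ (partialSum-suc t (i ℕ.* 2))) (R.+-assoc _ _ _))

  cosPartialSum : ∀ x i → partialSum (powerTerm re x) (i ℕ.* 2) ≈ partialSum (cosTerm x) i
  cosPartialSum x zero    = R.refl
  cosPartialSum x (suc i) = R.trans (partialSum-even (powerTerm re x) i)
    (R.trans (R.+-cong (cosPartialSum x i)
               (R.trans (R.+-cong (cosTerm≈ x i)
                                  (powerTerm-zero re x (suc (i ℕ.* 2)) (cong ℤ.-_ (im-even i))))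
                        (R.+-identityʳ (cosTerm x i))))
             (R.sym (partialSum-suc (cosTerm x) i)))

  sinPartialSum : ∀ x i → partialSum (powerTerm im x) (i ℕ.* 2) ≈ partialSum (sinTerm x) i
  sinPartialSum x zero    = R.refl
  sinPartialSum x (suc i) = R.trans (partialSum-even (powerTerm im x) i)
    (R.trans (R.+-cong (sinPartialSum x i)
               (R.trans (R.+-cong (powerTerm-zero im x (i ℕ.* 2) (im-even i)) (sinTerm≈ x i))
                        (R.+-identityˡ (sinTerm x i))))
             (R.sym (partialSum-suc (sinTerm x) i)))

  -- Cosine and sine on pℤₚ and their addition formulas

  3≤p : 3 ≤ p
  3≤p = ℕ.≤∧≢⇒< (ℕ.nonTrivial⇒n>1 p {{prime⇒nonTrivial p-prime}})
                 λ 2≡p → p-odd (subst (2 ∣_) 2≡p ∣-refl)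

  Small : Dom → Set
  Small x = ∣ point x ∣≤p^- 1

  powerTerm-integral : ∀ c x → ∣ x ∣≤p^- 1 → ∀ n → ∣ powerTerm c x n ∣≤p^- 0
  powerTerm-integral c x h n = term-ball 3≤p x h (c n) n 0 z≤n

  powerSeries-converges : ∀ c x → ∣ x ∣≤p^- 1 → Converges (partialSum (powerTerm c x))
  powerSeries-converges c x h = null-converges (powerTerm c x) λ k →
    2 ℕ.* k , λ {n} 2k≤n → term-ball 3≤p x h (c n) n k 2k≤n

  -- The partial sums of even length are a subsequence, so they determine the limit of a series
  -- already known to converge. This identifies the series padded with zeros at every other index
  -- with `cos` and `sin`.
  ⟶-from-even : ∀ t s {l} → Converges (partialSum t) → (∀ i → partialSum t (i ℕ.* 2) ≈ s i) →
                s ⟶ l → partialSum t ⟶ l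
  ⟶-from-even t s {l} (L , t⟶L) even s⟶l = ⟶-cong {partialSum t} {partialSum t} (λ _ → R.refl) L≈l t⟶L
    where
    L≈l : L ≈ l
    L≈l = ⟶-unique {s} (⟶-cong {λ i → partialSum t (i ℕ.* 2)} {s} even R.refl λ k →
      let N , h = t⟶L k in N , λ {n} N≤n → h (ℕ.≤-trans N≤n (ℕ.m≤m*n n 2))) s⟶l

  cos-series : ∀ x → Small x → partialSum (powerTerm re (point x)) ⟶ cos x
  cos-series x h = ⟶-from-even (powerTerm re (point x)) (partialSum (cosTerm (point x)))
    (powerSeries-converges re (point x) h) (cosPartialSum (point x)) (proj₂ (cosConverges x))

  sin-series : ∀ x → Small x → partialSum (powerTerm im (point x)) ⟶ sin x
  sin-series x h = ⟶-from-even (powerTerm im (point x)) (partialSum (sinTerm (point x)))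
    (powerSeries-converges im (point x) h) (sinPartialSum (point x)) (proj₂ (sinConverges x))

  cos-integral : ∀ x → Small x → ∣ cos x ∣≤p^- 0
  cos-integral x h = limit-integral (cos-series x h) (Ball-sum _ (powerTerm-integral re (point x) h))

  sin-integral : ∀ x → Small x → ∣ sin x ∣≤p^- 0
  sin-integral x h = limit-integral (sin-series x h) (Ball-sum _ (powerTerm-integral im (point x) h))

  /-neg : ∀ i n .{{_ : NonZero n}} → (ℤ.- i) / n ≡ ℚ.- (i / n)
  /-neg i (suc n) = ℚ.toℚᵘ-injective
    (ℚᵘ.≃-trans (ℚ.toℚᵘ-fromℚᵘ (mkℚᵘ (ℤ.- i) n))
    (ℚᵘ.≃-trans (ℚᵘ.≃-sym (ℚᵘ.-‿cong (ℚ.toℚᵘ-fromℚᵘ (mkℚᵘ i n))))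
                (ℚᵘ.≃-sym (ℚ.toℚᵘ-homo‿- (i / suc n)))))

  powerTerm-neg : ∀ c x n → powerTerm (ℤ.-_ ∘ c) x n ≈ (- powerTerm c x n)
  powerTerm-neg c x n = begin
    ι ((ℤ.- c n) /! n) * x ^ n   ≡⟨ cong (λ q → ι q * x ^ n) (/-neg (c n) (n !) {{n ℕ.!≢0}}) ⟩
    ι (ℚ.- (c n /! n)) * x ^ n   ≈⟨ R.*-congʳ (ι-neg (c n /! n)) ⟩
    - ι (c n /! n) * x ^ n       ≈⟨ solve 2 (λ a b → :- a :* b := :- (a :* b)) R.refl (ι (c n /! n)) (x ^ n) ⟩
    - powerTerm c x n            ∎
    where
    open ≈-R
    open ℚₚ-Solver

  partialSum-neg : ∀ t n → partialSum (λ i → - t i) n ≈ (- partialSum t n)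
  partialSum-neg t zero    = solve 0 (con 0ℚ := :- con 0ℚ) R.refl
    where open ℚₚ-Solver
  partialSum-neg t (suc n) = R.trans (R.+-congˡ (partialSum-neg (t ∘ suc) n))
    (solve 2 (λ a b → :- a :+ :- b := :- (a :+ b)) R.refl (t 0) (partialSum (t ∘ suc) n))
    where open ℚₚ-Solver

  partialSum-+ : ∀ t u n → partialSum (λ i → t i + u i) n ≈ (partialSum t n + partialSum u n)
  partialSum-+ t u n = ∑R.∑-distrib-+ {n} _ _

  ⟶-neg : ∀ {s l} → s ⟶ l → (λ n → - s n) ⟶ (- l)
  ⟶-neg {s} {l} h k =
    let N , f = h k
    in N , λ {n} n≥ → ≈⇒ball (solve 2 (λ a b → :- (a :- b) := :- a :- :- b) R.refl (s n) l)
                              (Ball-neg (f n≥))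
    where open ℚₚ-Solver

  powerTerm-cong : ∀ c {x y} → x ≈ y → ∀ n → powerTerm c x n ≈ powerTerm c y n
  powerTerm-cong c x≈y n = R.*-congˡ (^R.^-congˡ n x≈y)

  neg-sin-series : ∀ x → Small x → partialSum (powerTerm (ℤ.-_ ∘ im) (point x)) ⟶ (- sin x)
  neg-sin-series x h = ⟶-cong
    (λ n → R.trans (R.sym (partialSum-neg (powerTerm im (point x)) n))
             (partialSum-cong (λ i → R.sym (powerTerm-neg im (point x) i)) n))
    R.refl (⟶-neg (sin-series x h))

  module _ {x y z : Dom} (x-small : Small x) (y-small : Small y) (z-small : Small z)
           (z≈x+y : point z ≈ (point x + point y)) where

    power-addition : ∀ c c₁ d₁ c₂ d₂ →
      (∀ j k → c (j ℕ.+ k) ≡ c₁ j ℤ.* d₁ k ℤ.+ c₂ j ℤ.* d₂ k) →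
      ∀ {A B C D} →
      partialSum (powerTerm c₁ (point x)) ⟶ A → partialSum (powerTerm d₁ (point y)) ⟶ B →
      partialSum (powerTerm c₂ (point x)) ⟶ C → partialSum (powerTerm d₂ (point y)) ⟶ D →
      partialSum (powerTerm c (point z)) ⟶ (A * B + C * D)
    power-addition c c₁ d₁ c₂ d₂ c-+ hA hB hC hD = ⟶-cong
      (λ n → R.sym (R.trans
        (partialSum-cong (λ i → R.trans (powerTerm-cong c z≈x+y i)
                                  (powerTerm-+ c c₁ d₁ c₂ d₂ c-+ (point x) (point y) i)) n)
        (partialSum-+ (conv (powerTerm c₁ (point x)) (powerTerm d₁ (point y)))
                      (conv (powerTerm c₂ (point x)) (powerTerm d₂ (point y))) n)))
      R.refl
      (⟶-+ (cauchy-product (powerTerm-integral c₁ _ x-small) (powerTerm-integral d₁ _ y-small) hA hB)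
           (cauchy-product (powerTerm-integral c₂ _ x-small) (powerTerm-integral d₂ _ y-small) hC hD))

    cos-+ : cos z ≈ (cos x * cos y - sin x * sin y)
    cos-+ = R.trans
      (⟶-unique (cos-series z z-small)
        (power-addition re re re (ℤ.-_ ∘ im) im re-+ (cos-series x x-small) (cos-series y y-small)
          (neg-sin-series x x-small) (sin-series y y-small)))
      (solve 4 (λ a b c d → a :* b :+ :- c :* d := a :* b :- c :* d) R.refl
        (cos x) (cos y) (sin x) (sin y))
      where open ℚₚ-Solver

    sin-+ : sin z ≈ (sin x * cos y + cos x * sin y)
    sin-+ = R.trans
      (⟶-unique (sin-series z z-small)
        (power-addition im re im im re im-+ (cos-series x x-small) (sin-series y y-small)
          (sin-series x x-small) (cos-series y y-small)))
      (R.+-comm (cos x * sin y) (sin x * cos y))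

  -- Second-order estimates near 0

  ^-ball-* : ∀ {k} x n → ∣ x ∣≤p^- k → ∣ x ^ n ∣≤p^- (n ℕ.* k)
  ^-ball-* x zero    h = ι-integral p∤1
  ^-ball-* x (suc n) h = Ball-*-+ h (^-ball-* x n h)

  -- With `e = v(n!)` the valuation is at least `n (u + 1) - e = n u + (n - e)`. Here `n u ≥ 2 u`,
  -- and `2 e ≤ n` together with `n ≥ 2` gives `n - e ≥ 1`. At `u = 0` this final 1 is what makes
  -- `cos x ≡ 1` modulo `p`.
  higher-term-ball : ∀ {u x} → ∣ x ∣≤p^- suc u → ∀ i n → 2 ≤ n →
                     ∣ ι (i /! n) * x ^ n ∣≤p^- suc (2 ℕ.* u)
  higher-term-ball {u} {x} h i n 2≤n =
    let e , v , p∤v , n!≡ , 2e≤n = !-valuation 3≤p n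
        eventually N g = Ball-weaken (exponent e 2e≤n) (^-ball-* x n h)
    in eventually N λ l → ball-* {e} {suc (2 ℕ.* u)}
         (pᵏ*/-integral e i (n !) v {{n ℕ.!≢0}} p∤v n!≡) (g l)
    where
    exponent : ∀ e → 2 ℕ.* e ≤ n → suc (2 ℕ.* u) ℕ.+ e ≤ n ℕ.* suc u
    exponent e 2e≤n = begin
      suc (2 ℕ.* u) ℕ.+ e     ≡⟨ solve 2 (λ u e → con 1 :+ con 2 :* u :+ e := con 1 :+ e :+ con 2 :* u) refl u e ⟩
      suc e ℕ.+ 2 ℕ.* u       ≤⟨ ℕ.+-mono-≤ 1+e≤n (ℕ.*-monoˡ-≤ u 2≤n) ⟩
      n ℕ.+ n ℕ.* u           ≡⟨ ℕ.*-suc n u ⟨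
      n ℕ.* suc u             ∎
      where
      open ℕ.≤-Reasoning
      open ℕ-Solver
      1+e≤n : suc e ≤ n
      1+e≤n = ℕ.*-cancelˡ-≤ 2 (begin
        2 ℕ.* suc e           ≡⟨ ℕ.*-suc 2 e ⟩
        2 ℕ.+ 2 ℕ.* e         ≤⟨ ℕ.+-mono-≤ 2≤n 2e≤n ⟩
        n ℕ.+ n               ≡⟨ cong (n ℕ.+_) (ℕ.+-identityʳ n) ⟨
        2 ℕ.* n               ∎)

  tail-ball : ∀ {k} t {l} → partialSum t ⟶ l → (∀ n → ∣ t (suc n) ∣≤p^- k) → ∣ l - t 0 ∣≤p^- k
  tail-ball t t⟶l h = ⟶-ball (t 0) t⟶l (1 , λ { {suc n} _ →
    ≈⇒ball (R.sym (x+y-x≈y (t 0) (partialSum (t ∘ suc) n))) (Ball-sum (t ∘ suc) h n) })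

  cos-1-ball : ∀ {u} x → ∣ point x ∣≤p^- suc u → ∣ cos x - 1# ∣≤p^- suc (2 ℕ.* u)
  cos-1-ball {u} x h = ≈⇒ball (R.+-congˡ (R.-‿cong cosTerm₀))
    (tail-ball (cosTerm (point x)) (proj₂ (cosConverges x)) λ n →
      higher-term-ball {u} h (ℤ.-1ℤ ℤ.^ suc n) (2 ℕ.* suc n) (ℕ.*-monoʳ-≤ 2 (s≤s z≤n)))
    where
    cosTerm₀ : cosTerm (point x) 0 ≈ 1#
    cosTerm₀ = R.*-identityˡ 1#

  sin-x-ball : ∀ {u} x → ∣ point x ∣≤p^- suc u → ∣ sin x - point x ∣≤p^- suc (2 ℕ.* u)
  sin-x-ball {u} x h = ≈⇒ball (R.+-congˡ (R.-‿cong sinTerm₀))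
    (tail-ball (sinTerm (point x)) (proj₂ (sinConverges x)) λ n →
      higher-term-ball {u} h (ℤ.-1ℤ ℤ.^ suc n) (suc (2 ℕ.* suc n))
        (ℕ.m≤n⇒m≤1+n (ℕ.*-monoʳ-≤ 2 (s≤s z≤n))))
    where
    sinTerm₀ : sinTerm (point x) 0 ≈ point x
    sinTerm₀ = R.trans (R.*-identityˡ (point x * 1#)) (R.*-identityʳ (point x))

  sin-ball : ∀ {u} x → ∣ point x ∣≤p^- suc u → ∣ sin x ∣≤p^- suc u
  sin-ball {u} x h = ≈⇒ball (solve 2 (λ a b → (a :- b) :+ b := a) R.refl (sin x) (point x))
    (Ball-+ (Ball-weaken (s≤s (ℕ.m≤m+n u (u ℕ.+ 0))) (sin-x-ball x h)) h)
    where open ℚₚ-Solver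

  -- Parity of cosine and sine

  even-power : ∀ x i → (- x) ^ (2 ℕ.* i) ≈ x ^ (2 ℕ.* i)
  even-power x i = begin
    (- x) ^ (2 ℕ.* i)    ≈⟨ ^R.^-assocʳ (- x) 2 i ⟨
    ((- x) ^ 2) ^ i      ≈⟨ ^R.^-congˡ i (solve 1 (λ x → :- x :* (:- x :* con 1ℚ) := x :* (x :* con 1ℚ)) R.refl x) ⟩
    (x ^ 2) ^ i          ≈⟨ ^R.^-assocʳ x 2 i ⟩
    x ^ (2 ℕ.* i)        ∎
    where
    open ≈-R
    open ℚₚ-Solver

  module _ (x y : Dom) (y≈-x : point y ≈ (- point x)) where

    cos-neg : cos y ≈ cos x
    cos-neg = ⟶-unique (proj₂ (cosConverges y))
      (⟶-cong (partialSum-cong λ i → R.*-congˡ {ι (cosCoeff i)}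
          (R.sym (R.trans (^R.^-congˡ (2 ℕ.* i) y≈-x) (even-power (point x) i))))
        R.refl (proj₂ (cosConverges x)))

    sin-neg : sin y ≈ (- sin x)
    sin-neg = ⟶-unique (proj₂ (sinConverges y))
      (⟶-cong (λ n → R.sym (R.trans (partialSum-cong term n) (partialSum-neg (sinTerm (point x)) n)))
        R.refl (⟶-neg (proj₂ (sinConverges x))))
      where
      open ℚₚ-Solver
      term : ∀ i → sinTerm (point y) i ≈ (- sinTerm (point x) i)
      term i = R.trans
        (R.*-congˡ {ι (sinCoeff i)} (R.trans (^R.^-congˡ (1 ℕ.+ 2 ℕ.* i) y≈-x)
          (R.*-congˡ (even-power (point x) i))))
        (solve 3 (λ c x z → c :* (:- x :* z) := :- (c :* (x :* z))) R.refl
          (ι (sinCoeff i)) (point x) (point x ^ (2 ℕ.* i)))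

  -- The domain of convergence

  -- Cross-multiplying `x = p · u` shows that `p` divides `↥ x · ↧ u`; Euclid's lemma leaves only
  -- `↥ x`, because `u` is integral.
  ball-1⇒p∣↥ : ∀ x → ∣ x ∣ᵠ≤p^- 1 → p ∣ ℤ.∣ ↥ x ∣
  ball-1⇒p∣↥ x@record{} (ball u@record{} hu x≡pu) = [ id , (λ p∣↧u → contradiction p∣↧u hu) ]′
    (euclidsLemma ℤ.∣ ↥ x ∣ (↧ₙ u) p-prime
      (subst (p ∣_) (trans (cong ℤ.∣_∣ (sym cross)) (ℤ.abs-* (↥ x) (↧ u)))
        (subst (p ∣_) (sym (trans (ℤ.abs-* (+ p ℤ.* ↥ u) (↧ x)) (cong (ℕ._* ↧ₙ x) (ℤ.abs-* (+ p) (↥ u)))))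
          (∣-trans (m∣m*n ℤ.∣ ↥ u ∣) (m∣m*n (↧ₙ x))))))
    where
    cross : ↥ x ℤ.* ↧ u ≡ (+ p ℤ.* ↥ u) ℤ.* ↧ x
    cross with ℚᵘ.≃-trans (ℚᵘ.≃-reflexive (cong ℚ.toℚᵘ (trans x≡pu (cong (ℚ._* u) (ℚ.*-identityʳ pℚ)))))
               (ℚᵘ.≃-trans (ℚ.toℚᵘ-homo-* pℚ u)
                 (ℚᵘ.*-cong {v = ℚ.toℚᵘ u} (ℚ.toℚᵘ-fromℚᵘ (mkℚᵘ (+ p) 0)) ℚᵘ.≃-refl))
    ... | *≡* e = trans (cong (↥ x ℤ.*_) (cong +_ (sym (ℕ.+-identityʳ (↧ₙ u))))) e

  p∣↥⇒ball-1 : ∀ x → p-Integral x → p ∣ ℤ.∣ ↥ x ∣ → ∣ x ∣ᵠ≤p^- 1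
  p∣↥⇒ball-1 x hx p∣↥x with ℤ.divides z ↥x≡zp ← ℤ.∣ᵤ⇒∣ {+ p} {↥ x} p∣↥x =
    ball (z / ↧ₙ x) (/-integral z (↧ₙ x) hx)
      (trans (sym (ℚ.↥p/↧p≡p x))
      (trans (ℚ./-cong (trans ↥x≡zp (ℤ.*-comm z (+ p))) (sym (ℕ.*-identityˡ (↧ₙ x))))
      (trans (/-* (+ p) z 1 (↧ₙ x)) (cong (ℚ._* (z / ↧ₙ x)) (sym (ℚ.*-identityʳ pℚ))))))
      where instance _ = ℕ.m*n≢0 1 (↧ₙ x)

  -- `p` generates a prime ideal of ℤ₍ₚ₎. On numerators this is Euclid's lemma, as `↥ x · ↥ y` is a
  -- multiple of the reduced numerator of `x ℚ.* y`.
  ball-1-prime : ∀ x y → p-Integral x → p-Integral y → ∣ x ℚ.* y ∣ᵠ≤p^- 1 →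
                 ∣ x ∣ᵠ≤p^- 1 ⊎ ∣ y ∣ᵠ≤p^- 1
  ball-1-prime x y hx hy h = Sum.map (p∣↥⇒ball-1 x hx) (p∣↥⇒ball-1 y hy)
    (euclidsLemma ℤ.∣ ↥ x ∣ ℤ.∣ ↥ y ∣ p-prime
      (subst (p ∣_)
        (trans (sym (ℤ.abs-* (↥ (x ℚ.* y)) _)) (trans (cong ℤ.∣_∣ (ℚ.↥-* x y)) (ℤ.abs-* (↥ x) (↥ y))))
        (∣-trans (ball-1⇒p∣↥ (x ℚ.* y) h) (m∣m*n _))))

  ^-integral : ∀ x n → p-Integral x → p-Integral (x ^ᵠ n)
  ^-integral x zero    hx = p∤1
  ^-integral x (suc n) hx = *-integral x (x ^ᵠ n) hx (^-integral x n hx)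

  ball-1-root : ∀ x n → p-Integral x → ∣ x ^ᵠ n ∣ᵠ≤p^- 1 → ∣ x ∣ᵠ≤p^- 1
  ball-1-root x zero    hx h = contradiction (ball-1⇒p∣↥ 1ℚ h) p∤1
  ball-1-root x (suc n) hx h =
    [ id , ball-1-root x n hx ]′ (ball-1-prime x (x ^ᵠ n) hx (^-integral x n hx) h)

  seq-^ : ∀ x m n → seq (x ^ m) n ≡ seq x n ^ᵠ m
  seq-^ x zero    n = refl
  seq-^ x (suc m) n = cong (seq x n ℚ.*_) (seq-^ x m n)

  ball-0⇒integral : ∀ {x} → ∣ x ∣ᵠ≤p^- 0 → p-Integral x
  ball-0⇒integral (ball u hu refl) = subst p-Integral (sym (ℚ.*-identityˡ u)) hu

  p∣! : ∀ n → p ≤ n → p ∣ n !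
  p∣! n p≤n = ∣-trans (p∣p! p {{prime⇒nonZero p-prime}}) (m≤n⇒m!∣n! p≤n)
    where
    p∣p! : ∀ m .{{_ : NonZero m}} → m ∣ m !
    p∣p! (suc m) = m∣m*n (m !)

  unit² : ∀ i → (ℤ.-1ℤ ℤ.^ i) ℤ.* (ℤ.-1ℤ ℤ.^ i) ≡ + 1
  unit² zero    = refl
  unit² (suc i) = trans
    (solve 1 (λ s → (con ℤ.-1ℤ :* s) :* (con ℤ.-1ℤ :* s) := s :* s) refl (ℤ.-1ℤ ℤ.^ i)) (unit² i)
    where open ℤ-Solver

  -- Multiplication by `s · n!`, where `s = (-1)^i` is its own inverse, recovers `q` from the
  -- integral number `u`, and `n! = w · p` supplies the factor `p`.
  power-over-!-ball : ∀ q i n → p ≤ n → ∣ ((ℤ.-1ℤ ℤ.^ i) /! n) ℚ.* q ∣ᵠ≤p^- 0 → ∣ q ∣ᵠ≤p^- 1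
  power-over-!-ball q i n p≤n (ball u hu e) with divides w n!≡wp ← p∣! n p≤n =
    ball (((s / 1) ℚ.* (+ w / 1)) ℚ.* u)
      (*-integral ((s / 1) ℚ.* (+ w / 1)) u
        (*-integral (s / 1) (+ w / 1) (/-integral s 1 p∤1) (/-integral (+ w) 1 p∤1)) hu)
      (begin
        q
          ≡⟨ ℚ.*-identityˡ q ⟨
        (+ 1 / 1) ℚ.* q
          ≡⟨ cong (λ z → (z / 1) ℚ.* q) (unit² i) ⟨
        ((s ℤ.* s) / 1) ℚ.* q
          ≡⟨ cong (ℚ._* q) (/-* s s 1 1) ⟩
        ((s / 1) ℚ.* (s / 1)) ℚ.* q
          ≡⟨ cong (λ z → ((s / 1) ℚ.* z) ℚ.* q) (/-cancel (n !) s 1 (n !) (sym (ℕ.*-identityʳ (n !)))) ⟨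
        ((s / 1) ℚ.* ((+ (n !) / 1) ℚ.* (s /! n))) ℚ.* q
          ≡⟨ solve 4 (λ s m c q → (s :* (m :* c)) :* q := (s :* m) :* (c :* q)) refl
               (s / 1) (+ (n !) / 1) (s /! n) q ⟩
        ((s / 1) ℚ.* (+ (n !) / 1)) ℚ.* ((s /! n) ℚ.* q)
          ≡⟨ cong₂ (λ m z → ((s / 1) ℚ.* m) ℚ.* z) n!/1 e ⟩
        ((s / 1) ℚ.* ((+ w / 1) ℚ.* pℚ)) ℚ.* (1ℚ ℚ.* u)
          ≡⟨ solve 4 (λ s w P u → (s :* (w :* P)) :* (con 1ℚ :* u) := (P :* con 1ℚ) :* ((s :* w) :* u)) refl
               (s / 1) (+ w / 1) pℚ u ⟩
        (pℚ ℚ.* 1ℚ) ℚ.* (((s / 1) ℚ.* (+ w / 1)) ℚ.* u) ∎)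
    where
    s = ℤ.-1ℤ ℤ.^ i
    instance _ = n ℕ.!≢0
    open +-*-Solver
    open ≡-Reasoning
    n!/1 : + (n !) / 1 ≡ (+ w / 1) ℚ.* pℚ
    n!/1 = trans (cong (_/ 1) (trans (cong +_ n!≡wp) (ℤ.pos-* w p))) (/-* (+ w) (+ p) 1 1)

  -- For n ≥ p the term aⁿ/n! can only be integral if p divides a.
  integral⇒small : ∀ a → ∣ point a ∣≤p^- 0 → Small a
  integral⇒small a (eventually N h) =
    let M , g = terms-null (cosTerm (point a)) (cosConverges a) 0
        -- Adding `M` makes the term integral, adding `p` makes `(2i)!` divisible by `p`.
        i = M ℕ.+ p
        eventually L f = g (ℕ.m≤m+n M p)
        p≤2i = ℕ.≤-trans (ℕ.m≤n+m p M) (ℕ.m≤m+n i (i ℕ.+ 0))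
    in eventually (N ⊔ L) λ {n} n≥ →
      ball-1-root (seq (point a) n) (2 ℕ.* i) (ball-0⇒integral (h (⊔ˡ n≥)))
        (power-over-!-ball (seq (point a) n ^ᵠ (2 ℕ.* i)) i (2 ℕ.* i) p≤2i
          (subst (λ q → ∣ cosCoeff i ℚ.* q ∣ᵠ≤p^- 0) (seq-^ (point a) (2 ℕ.* i) n) (f (⊔ʳ {N} n≥))))

  -- Inverses of numbers congruent to 1 modulo p

  ⟶-*ˡ : ∀ x {s l} → s ⟶ l → (λ n → x * s n) ⟶ (x * l)
  ⟶-*ˡ x {s} {l} h k =
    let b , x* = Ball-*ˡ x
        N , g = h (k ℕ.+ b)
    in N , λ {n} n≥ → ≈⇒ball (solve 3 (λ x s l → x :* (s :- l) := x :* s :- x :* l) R.refl x (s n) l)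
                              (x* (g n≥))
    where open ℚₚ-Solver

  geometric-sum : ∀ w n → ((1# - w) * partialSum (w ^_) n) ≈ (1# - w ^ n)
  geometric-sum w zero    = solve 1 (λ w → (con 1ℚ :- w) :* con 0ℚ := con 1ℚ :- con 1ℚ) R.refl w
    where open ℚₚ-Solver
  geometric-sum w (suc n) = begin
    (1# - w) * partialSum (w ^_) (suc n)              ≈⟨ R.*-congˡ (partialSum-suc (w ^_) n) ⟩
    (1# - w) * (partialSum (w ^_) n + w ^ n)          ≈⟨ R.distribˡ (1# - w) (partialSum (w ^_) n) (w ^ n) ⟩
    (1# - w) * partialSum (w ^_) n + (1# - w) * w ^ n ≈⟨ R.+-congʳ (geometric-sum w n) ⟩
    (1# - w ^ n) + (1# - w) * w ^ n
      ≈⟨ solve 2 (λ w W → (con 1ℚ :- W) :+ (con 1ℚ :- w) :* W := con 1ℚ :- w :* W) R.refl w (w ^ n) ⟩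
    1# - w ^ suc n                                    ∎
    where
    open ≈-R
    open ℚₚ-Solver

  -- The inverse is the geometric series `Σ (1 - x)^n`, which converges because its `n`-th term lies
  -- in `p^n ℤₚ`.
  1+ball-invertible : ∀ x → ∣ x - 1# ∣≤p^- 1 → Invertible x
  1+ball-invertible x h = S , R.trans (R.*-comm S x) xS≈1 , xS≈1
    where
    w = 1# - x
    w^-ball : ∀ {k n} → k ≤ n → ∣ w ^ n ∣≤p^- k
    w^-ball {k} {n} k≤n = Ball-weaken k≤n (^-ball-p w (ball-sym h) n)
    series : Converges (partialSum (w ^_))
    series = null-converges (w ^_) λ k → k , w^-ball
    S = proj₁ series
    xS≈1 : (x * S) ≈ 1#
    xS≈1 = ⟶-unique
      (⟶-cong {s′ = λ n → 1# - w ^ n} (λ n → R.trans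
          (R.*-congʳ (solve 1 (λ x → x := con 1ℚ :- (con 1ℚ :- x)) R.refl x)) (geometric-sum w n))
        R.refl (⟶-*ˡ x (proj₂ series)))
      λ k → k , λ {n} k≤n → ≈⇒ball
        (solve 1 (λ W → :- W := (con 1ℚ :- W) :- con 1ℚ) R.refl (w ^ n)) (Ball-neg (w^-ball k≤n))
      where open ℚₚ-Solver

  -- Strict differentiability

  -- The error of the linear approximation has three sources: the second-order remainder `r`, the
  -- deviation of `s` from `a * h`, and the change of the slope from `c` to `u`.
  linearise : ∀ D r u s c a h → D ≈ (r + u * s) →
              (D - (c * a) * h) ≈ (r + u * (s - a * h) + (u - c) * (a * h))
  linearise D r u s c a h D≈ = R.trans (R.+-cong D≈ (R.-‿cong (R.*-assoc c a h)))
    (solve 5 (λ r u s c e → (r :+ u :* s) :- c :* e := r :+ u :* (s :- e) :+ (u :- c) :* e) R.refl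
      r u s c (a * h))
    where open ℚₚ-Solver

  infixl 6 _-ℤ_
  _-ℤ_ : ℤₚ → ℤₚ → ℤₚ
  x -ℤ y = mkℤₚ (value x - value y) (Ball-+ (integral x) (Ball-neg (integral y)))

  x≈y+[x-y] : ∀ x y → x ≈ (y + (x - y))
  x≈y+[x-y] = solve 2 (λ x y → x := y :+ (x :- y)) R.refl
    where open ℚₚ-Solver

  cos-difference : ∀ c s C S {z} → z ≈ (c * C - s * S) → (z - c) ≈ (c * (C - 1#) + (- s) * S)
  cos-difference c s C S e = R.trans (R.+-congʳ e)
    (solve 4 (λ c s C S → c :* C :- s :* S :- c := c :* (C :- con 1ℚ) :+ (:- s) :* S) R.refl c s C S)
    where open ℚₚ-Solver

  sin-difference : ∀ c s C S {z} → z ≈ (s * C + c * S) → (z - s) ≈ (s * (C - 1#) + c * S)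
  sin-difference c s C S e = R.trans (R.+-congʳ e)
    (solve 4 (λ c s C S → s :* C :+ c :* S :- s := s :* (C :- con 1ℚ) :+ c :* S) R.refl c s C S)
    where open ℚₚ-Solver

  neg-- : ∀ x y → (- (x - y)) ≈ ((- x) - (- y))
  neg-- = solve 2 (λ x y → :- (x :- y) := :- x :- :- y) R.refl
    where open ℚₚ-Solver

  Lipschitz : (ℤₚ → ℚₚ) → Set
  Lipschitz f = ∀ {k} x y → ∣ value x - value y ∣≤p^- k → ∣ f x - f y ∣≤p^- k

  -- f (y + h) = f y + f y C h + g y S h with C h = O(h²) and S h = r h + O(h²)
  module AdditionFormula {f g C S : ℤₚ → ℚₚ} {r : ℚₚ}
    (f-integral : ∀ x → ∣ f x ∣≤p^- 0) (g-integral : ∀ x → ∣ g x ∣≤p^- 0) (r-integral : ∣ r ∣≤p^- 0)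
    (C-ball : ∀ {u} h → ∣ value h ∣≤p^- u → ∣ C h ∣≤p^- (2 ℕ.* u))
    (S-ball : ∀ {u} h → ∣ value h ∣≤p^- u → ∣ S h - r * value h ∣≤p^- (2 ℕ.* u))
    (difference : ∀ x y → (f x - f y) ≈ (f y * C (x -ℤ y) + g y * S (x -ℤ y)))
    where

    lipschitz : Lipschitz f
    lipschitz {k} x y h = ≈⇒ball (R.sym (difference x y))
      (Ball-+ (Ball-*-+ (f-integral y) (Ball-weaken k≤2k (C-ball (x -ℤ y) h)))
              (Ball-*-+ (g-integral y)
                (≈⇒ball (solve 2 (λ a b → (a :- b) :+ b := a) R.refl (S (x -ℤ y)) (r * value (x -ℤ y)))
                  (Ball-+ (Ball-weaken k≤2k (S-ball (x -ℤ y) h)) (Ball-*-+ r-integral h)))))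
      where
      open ℚₚ-Solver
      k≤2k : k ≤ 2 ℕ.* k
      k≤2k = ℕ.m≤m+n k (k ℕ.+ 0)

    strictlyDifferentiable : Lipschitz g → StrictlyDifferentiable f
    strictlyDifferentiable g-lipschitz c = (g c * r) , λ k → k , derivative k
      where
      derivative : ∀ k x y → ∣ value x - value c ∣≤p^- k → ∣ value y - value c ∣≤p^- k →
                   ∀ j → ∣ value x - value y ∣≤p^- j →
                   ∣ (f x - f y) - (g c * r) * (value x - value y) ∣≤p^- (k ℕ.+ j)
      derivative k x y x-c y-c j x-y = ≈⇒ball
        (R.sym (linearise (f x - f y) (f y * C d) (g y) (S d) (g c) r (value d) (difference x y)))
        (Ball-+ (Ball-+ (Ball-*-+ (f-integral y) (Ball-weaken k+j≤ (C-ball d d-ball)))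
                        (Ball-*-+ (g-integral y) (Ball-weaken k+j≤ (S-ball d d-ball))))
                (Ball-*-+ (g-lipschitz y c y-c) (Ball-*-+ r-integral x-y)))
        where
        d = x -ℤ y
        -- Both points are within `p⁻ᵏ` of `c`, hence of each other. So a quantity of second order
        -- in `d` has exponent `2 (k ⊔ j)`, which is at least `k + j`.
        d-ball : ∣ value d ∣≤p^- (k ⊔ j)
        d-ball = [ (λ e → subst (∣ value d ∣≤p^-_) (sym e) (ball-trans {y = value c} x-c (ball-sym y-c)))
                 , (λ e → subst (∣ value d ∣≤p^-_) (sym e) x-y) ]′ (ℕ.⊔-sel k j)
        k+j≤ : k ℕ.+ j ≤ 2 ℕ.* (k ⊔ j)
        k+j≤ = ℕ.+-mono-≤ (ℕ.m≤m⊔n k j) (ℕ.≤-trans (ℕ.m≤n⊔m k j) (ℕ.m≤m+n (k ⊔ j) 0))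

  module _ {a : Dom} (a-small : Small a) where
    ·-ball : ∀ {k} x → ∣ value x ∣≤p^- k → ∣ point (a · x) ∣≤p^- suc k
    ·-ball x h = Ball-*-+ a-small h

    ·-small : ∀ x → Small (a · x)
    ·-small x = ·-ball x (integral x)

    cosₐ-integral : ∀ x → ∣ cos (a · x) ∣≤p^- 0
    cosₐ-integral x = cos-integral (a · x) (·-small x)

    sinₐ-integral : ∀ x → ∣ sin (a · x) ∣≤p^- 0
    sinₐ-integral x = sin-integral (a · x) (·-small x)

    ·-distrib-+ : ∀ x y z → value z ≈ (value x + value y) → point (a · z) ≈ (point (a · x) + point (a · y))
    ·-distrib-+ x y z e = R.trans (R.*-congˡ e) (R.distribˡ (point a) (value x) (value y))

    cosₐ-+ : ∀ x y z → value z ≈ (value x + value y) →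
             cos (a · z) ≈ (cos (a · x) * cos (a · y) - sin (a · x) * sin (a · y))
    cosₐ-+ x y z e = cos-+ {a · x} {a · y} {a · z} (·-small x) (·-small y) (·-small z) (·-distrib-+ x y z e)

    sinₐ-+ : ∀ x y z → value z ≈ (value x + value y) →
             sin (a · z) ≈ (sin (a · x) * cos (a · y) + cos (a · x) * sin (a · y))
    sinₐ-+ x y z e = sin-+ {a · x} {a · y} {a · z} (·-small x) (·-small y) (·-small z) (·-distrib-+ x y z e)

    cosₐ-1-ball : ∀ {u} x → ∣ value x ∣≤p^- u → ∣ cos (a · x) - 1# ∣≤p^- (2 ℕ.* u)
    cosₐ-1-ball x h = Ball-weaken (ℕ.n≤1+n _) (cos-1-ball (a · x) (·-ball x h))

    sinₐ-x-ball : ∀ {u} x → ∣ value x ∣≤p^- u → ∣ sin (a · x) - point a * value x ∣≤p^- (2 ℕ.* u)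
    sinₐ-x-ball x h = Ball-weaken (ℕ.n≤1+n _) (sin-x-ball (a · x) (·-ball x h))

    private
      module cosₐ = AdditionFormula
        {λ x → cos (a · x)} {λ x → - sin (a · x)} {λ x → cos (a · x) - 1#} {λ x → sin (a · x)} {point a}
        cosₐ-integral (λ x → Ball-neg (sinₐ-integral x)) (Ball-weaken z≤n a-small) cosₐ-1-ball sinₐ-x-ball
        (λ x y → cos-difference (cos (a · y)) (sin (a · y)) (cos (a · (x -ℤ y))) (sin (a · (x -ℤ y)))
          (cosₐ-+ y (x -ℤ y) x (x≈y+[x-y] (value x) (value y))))
      module sinₐ = AdditionFormula
        {λ x → sin (a · x)} {λ x → cos (a · x)} {λ x → cos (a · x) - 1#} {λ x → sin (a · x)} {point a}
        sinₐ-integral cosₐ-integral (Ball-weaken z≤n a-small) cosₐ-1-ball sinₐ-x-ball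
        (λ x y → sin-difference (cos (a · y)) (sin (a · y)) (cos (a · (x -ℤ y))) (sin (a · (x -ℤ y)))
          (sinₐ-+ y (x -ℤ y) x (x≈y+[x-y] (value x) (value y))))

    -- The companion `g` of cosine is minus sine and that of sine is cosine, so each derivative uses
    -- the Lipschitz bound of the other function. This is why `lipschitz` is separate from
    -- `strictlyDifferentiable`.
    cosₐ-strictlyDifferentiable : StrictlyDifferentiable λ x → cos (a · x)
    cosₐ-strictlyDifferentiable = cosₐ.strictlyDifferentiable λ x y h →
      ≈⇒ball (neg-- (sin (a · x)) (sin (a · y))) (Ball-neg (sinₐ.lipschitz x y h))

    sinₐ-strictlyDifferentiable : StrictlyDifferentiable λ x → sin (a · x)
    sinₐ-strictlyDifferentiable = sinₐ.strictlyDifferentiable cosₐ.lipschitz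

  -- Alternating sums

  -- `(-1)^x (G x + G (x+1))` is the difference of `(-1)^x G x` at `x` and `x + 1`. The factor `r`
  -- stays on the left, so that division by `2 cos t` happens only once, in the limit.
  telescope : ∀ r (e G : ℕ → ℚₚ) → (∀ x → (r * e x) ≈ (G x + G (suc x))) →
              ∀ M → (r * partialSum (λ x → e x * (- 1#) ^ x) M) ≈ (G 0 - (- 1#) ^ M * G M)
  telescope r e G h zero    = solve 2 (λ r g → r :* con 0ℚ := g :- con 1ℚ :* g) R.refl r (G 0)
    where open ℚₚ-Solver
  telescope r e G h (suc M) = begin
    r * partialSum t (suc M)                             ≈⟨ R.*-congˡ (partialSum-suc t M) ⟩
    r * (partialSum t M + e M * σ)
      ≈⟨ solve 4 (λ r P e σ → r :* (P :+ e :* σ) := r :* P :+ σ :* (r :* e)) R.refl r (partialSum t M) (e M) σ ⟩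
    r * partialSum t M + σ * (r * e M)                   ≈⟨ R.+-cong (telescope r e G h M) (R.*-congˡ (h M)) ⟩
    (G 0 - σ * G M) + σ * (G M + G (suc M))
      ≈⟨ solve 4 (λ g σ x y → (g :- σ :* x) :+ σ :* (x :+ y) := g :- ((:- con 1ℚ) :* σ) :* y) R.refl
           (G 0) σ (G M) (G (suc M)) ⟩
    G 0 - (- 1#) ^ suc M * G (suc M)                     ∎
    where
    t = λ x → e x * (- 1#) ^ x
    σ = (- 1#) ^ M
    open ≈-R
    open ℚₚ-Solver

  1^n≈1 : ∀ n → 1# ^ n ≈ 1#
  1^n≈1 zero    = R.refl
  1^n≈1 (suc n) = R.trans (R.*-identityˡ (1# ^ n)) (1^n≈1 n)

  [-1]^p≈-1 : (- 1#) ^ p ≈ (- 1#)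
  [-1]^p≈-1 = begin
    (- 1#) ^ p                  ≡⟨ cong ((- 1#) ^_) p≡1+2q ⟩
    (- 1#) * (- 1#) ^ (2 ℕ.* q) ≈⟨ R.*-congˡ (even-power 1# q) ⟩
    (- 1#) * 1# ^ (2 ℕ.* q)     ≈⟨ R.*-congˡ (1^n≈1 (2 ℕ.* q)) ⟩
    (- 1#) * 1#                 ≈⟨ R.*-identityʳ (- 1#) ⟩
    - 1#                        ∎
    where
    open ≈-R
    q = p ℕ./ 2
    p%2≡1 : p % 2 ≡ 1
    p%2≡1 with p % 2 in e | m%n<n p 2
    ... | 0 | _ = contradiction (m%n≡0⇒n∣m p 2 e) p-odd
    ... | 1 | _ = refl
    ... | suc (suc _) | s≤s (s≤s ())
    p≡1+2q : p ≡ suc (2 ℕ.* q)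
    p≡1+2q = trans (m≡m%n+[m/n]*n p 2) (cong₂ ℕ._+_ p%2≡1 (ℕ.*-comm q 2))

  [-1]^pᴺ≈-1 : ∀ N → (- 1#) ^ (p ℕ.^ N) ≈ (- 1#)
  [-1]^pᴺ≈-1 zero    = R.*-identityʳ (- 1#)
  [-1]^pᴺ≈-1 (suc N) = R.trans (R.sym (^R.^-assocʳ (- 1#) p (p ℕ.^ N)))
    (R.trans (^R.^-congˡ (p ℕ.^ N) [-1]^p≈-1) ([-1]^pᴺ≈-1 N))

  pᴺ-ball : ∀ N → ∣ value (fromℕ (p ℕ.^ N)) ∣≤p^- N
  pᴺ-ball N = eventually 0 λ _ → ball 1ℚ p∤1 (trans (sym (pᵏ≡ N)) (sym (ℚ.*-identityʳ (pℚ ^ᵠ N))))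

  -- The length `p^N` enters twice: being odd, it turns the boundary terms into `G 0 + G (p^N)`;
  -- being `p`-adically small, it lets `G (p^N)` converge.
  fermionicSum-limit : ∀ (f : ℤₚ → ℚₚ) (G : ℕ → ℚₚ) {r r⁻¹ G∞ I} → (r⁻¹ * r) ≈ 1# →
    (∀ x → (r * f (fromℕ x)) ≈ (G x + G (suc x))) →
    (∀ N → ∣ G (p ℕ.^ N) - G∞ ∣≤p^- N) → (G 0 + G∞) ≈ (r * I) → fermionicSum f ⟶ I
  fermionicSum-limit f G {r} {r⁻¹} {G∞} {I} inverse step G-ball total = ⟶-cong
    {λ N → r⁻¹ * (G 0 + G (p ℕ.^ N))} {fermionicSum f} {r⁻¹ * (G 0 + G∞)} {I}
    (λ N → R.trans (R.*-congˡ (R.sym (sum≈ N))) (cancel (fermionicSum f N)))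
    (R.trans (R.*-congˡ total) (cancel I))
    (⟶-*ˡ r⁻¹ λ k → k , λ {N} k≤N → ≈⇒ball
      (solve 3 (λ a b c → b :- c := a :+ b :- (a :+ c)) R.refl (G 0) (G (p ℕ.^ N)) G∞)
      (Ball-weaken k≤N (G-ball N)))
    where
    open ℚₚ-Solver
    cancel : ∀ x → (r⁻¹ * (r * x)) ≈ x
    cancel x = R.trans (R.sym (R.*-assoc r⁻¹ r x)) (R.trans (R.*-congʳ inverse) (R.*-identityˡ x))
    sum≈ : ∀ N → (r * fermionicSum f N) ≈ (G 0 + G (p ℕ.^ N))
    sum≈ N = R.trans (telescope r (f ∘ fromℕ) G step (p ℕ.^ N))
      (R.trans (R.+-congˡ (R.-‿cong (R.*-congʳ ([-1]^pᴺ≈-1 N))))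
        (solve 2 (λ a b → a :- (:- con 1ℚ) :* b := a :+ b) R.refl (G 0) (G (p ℕ.^ N))))

  -- Identifies `(n + 1) - ½` with `n + ½`, so the subtraction formula at `n + 1` and the addition
  -- formula at `n` describe the same value.
  suc-n-½ : ∀ {h} → h ≈ ι ½ → ∀ n → (value (fromℕ (suc n)) - h) ≈ (value (fromℕ n) + h)
  suc-n-½ {h} h≈½ n = begin
    value (fromℕ (suc n)) - h    ≈⟨ R.+-cong (R.trans (R.reflexive (cong ι (/-+ (+ 1) (+ n) 1))) (ι-+ 1ℚ (+ n / 1)))
                                             (R.-‿cong h≈½) ⟩
    (1# + ι (+ n / 1)) - ι ½     ≈⟨ solve 1 (λ n → (con 1ℚ :+ n) :- con ½ := n :+ con ½) R.refl (ι (+ n / 1)) ⟩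
    value (fromℕ n) + ι ½        ≈⟨ R.+-congˡ h≈½ ⟨
    value (fromℕ n) + h          ∎
    where
    open ≈-R
    open ℚₚ-Solver

  -- Evaluation of the two integrals

  -ℤ_ : ℤₚ → ℤₚ
  -ℤ x = mkℤₚ (- value x) (Ball-neg (integral x))

  -- `C` and `S` stand for `cos (ax)` and `sin (ax)`, known here by their addition formulas, parity
  -- and behaviour near 0. The values at `t = a/2` are `C h` and `S h`.
  module Fermionic {C S : ℤₚ → ℚₚ} {h : ℤₚ} (h≈½ : value h ≈ ι ½)
    (C-integral : ∀ x → ∣ C x ∣≤p^- 0) (S-integral : ∀ x → ∣ S x ∣≤p^- 0)
    (C-unit : ∀ x → ∣ C x - 1# ∣≤p^- 1)
    (C-1-ball : ∀ {k} x → ∣ value x ∣≤p^- k → ∣ C x - 1# ∣≤p^- k)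
    (S-ball : ∀ {k} x → ∣ value x ∣≤p^- k → ∣ S x ∣≤p^- k)
    (C-+ : ∀ x y z → value z ≈ (value x + value y) → C z ≈ (C x * C y - S x * S y))
    (S-+ : ∀ x y z → value z ≈ (value x + value y) → S z ≈ (S x * C y + C x * S y))
    (C-neg : ∀ x → C (-ℤ x) ≈ C x) (S-neg : ∀ x → S (-ℤ x) ≈ (- S x))
    where
    open ℚₚ-Solver

    C-- : ∀ x y z → value z ≈ (value x - value y) → C z ≈ (C x * C y + S x * S y)
    C-- x y z e = R.trans (C-+ x (-ℤ y) z e)
      (R.trans (R.+-cong (R.*-congˡ (C-neg y)) (R.-‿cong (R.*-congˡ (S-neg y))))
        (solve 3 (λ u s t → u :- s :* :- t := u :+ s :* t) R.refl (C x * C y) (S x) (S y)))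

    S-- : ∀ x y z → value z ≈ (value x - value y) → S z ≈ (S x * C y - C x * S y)
    S-- x y z e = R.trans (S-+ x (-ℤ y) z e)
      (R.+-cong (R.*-congˡ (C-neg y))
        (R.trans (R.*-congˡ (S-neg y)) (solve 2 (λ s t → s :* :- t := :- (s :* t)) R.refl (C x) (S y))))

    -- `z` is any representative of 0, such as `h -ℤ h` or `fromℕ 0`; it lies in every ball, so the
    -- estimates near 0 become equalities.
    module _ (z : ℤₚ) (z≈0 : value z ≈ 0#) where
      private
        z-ball : ∀ k → ∣ value z ∣≤p^- k
        z-ball k = ≈⇒ball (R.sym z≈0) (Ball-0 k)

      C-0 : C z ≈ 1#
      C-0 = mk≈ λ k → C-1-ball z (z-ball k)

      S-0 : S z ≈ 0#
      S-0 = mk≈ λ k → ≈⇒ball (R.sym (x-0≈x (S z))) (S-ball z (z-ball k))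

    c s : ℚₚ
    c = C h
    s = S h

    pythagoras : (c * c + s * s) ≈ 1#
    pythagoras = R.trans (R.sym (C-- h h (h -ℤ h) R.refl)) (C-0 (h -ℤ h) (R.-‿inverseʳ (value h)))

    c-invertible : Invertible (C h)
    c-invertible = 1+ball-invertible c (C-unit h)

    v : ℚₚ
    v = proj₁ c-invertible

    vc≈1 : (v * c) ≈ 1#
    vc≈1 = proj₁ (proj₂ c-invertible)

    2c-inverse : ((ι ½ * v) * (c + c)) ≈ 1#
    2c-inverse = R.trans (solve 2 (λ v c → (con ½ :* v) :* (c :+ c) := v :* c) R.refl v c) vc≈1

    -- C and S at the half-integer n - ½
    C⁻ S⁻ : ℕ → ℚₚ
    C⁻ n = C (fromℕ n) * c + S (fromℕ n) * s
    S⁻ n = S (fromℕ n) * c - C (fromℕ n) * s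

    C⁻-suc : ∀ n → C⁻ (suc n) ≈ (C (fromℕ n) * c - S (fromℕ n) * s)
    C⁻-suc n = R.trans (R.sym (C-- (fromℕ (suc n)) h (fromℕ (suc n) -ℤ h) R.refl))
      (C-+ (fromℕ n) h (fromℕ (suc n) -ℤ h) (suc-n-½ h≈½ n))

    S⁻-suc : ∀ n → S⁻ (suc n) ≈ (S (fromℕ n) * c + C (fromℕ n) * s)
    S⁻-suc n = R.trans (R.sym (S-- (fromℕ (suc n)) h (fromℕ (suc n) -ℤ h) R.refl))
      (S-+ (fromℕ n) h (fromℕ (suc n) -ℤ h) (suc-n-½ h≈½ n))

    C-step : ∀ n → ((c + c) * C (fromℕ n)) ≈ (C⁻ n + C⁻ (suc n))
    C-step n = R.trans
      (solve 4 (λ x y c s → (c :+ c) :* x := (x :* c :+ y :* s) :+ (x :* c :- y :* s)) R.refl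
        (C (fromℕ n)) (S (fromℕ n)) c s)
      (R.+-congˡ (R.sym (C⁻-suc n)))

    S-step : ∀ n → ((c + c) * S (fromℕ n)) ≈ (S⁻ n + S⁻ (suc n))
    S-step n = R.trans
      (solve 4 (λ x y c s → (c :+ c) :* y := (y :* c :- x :* s) :+ (y :* c :+ x :* s)) R.refl
        (C (fromℕ n)) (S (fromℕ n)) c s)
      (R.+-congˡ (R.sym (S⁻-suc n)))

    C-pᴺ : ∀ N → ∣ C (fromℕ (p ℕ.^ N)) - 1# ∣≤p^- N
    C-pᴺ N = C-1-ball (fromℕ (p ℕ.^ N)) (pᴺ-ball N)

    S-pᴺ : ∀ N → ∣ S (fromℕ (p ℕ.^ N)) ∣≤p^- N
    S-pᴺ N = S-ball (fromℕ (p ℕ.^ N)) (pᴺ-ball N)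

    C⁻-pᴺ : ∀ N → ∣ C⁻ (p ℕ.^ N) - c ∣≤p^- N
    C⁻-pᴺ N = ≈⇒ball
      (solve 4 (λ x y c s → (x :- con 1ℚ) :* c :+ y :* s := (x :* c :+ y :* s) :- c) R.refl
        (C (fromℕ (p ℕ.^ N))) (S (fromℕ (p ℕ.^ N))) c s)
      (Ball-+ (Ball-* (C-pᴺ N) (C-integral h)) (Ball-* (S-pᴺ N) (S-integral h)))

    S⁻-pᴺ : ∀ N → ∣ S⁻ (p ℕ.^ N) - (- s) ∣≤p^- N
    S⁻-pᴺ N = ≈⇒ball
      (solve 4 (λ x y c s → y :* c :- (x :- con 1ℚ) :* s := (y :* c :- x :* s) :- (:- s)) R.refl
        (C (fromℕ (p ℕ.^ N))) (S (fromℕ (p ℕ.^ N))) c s)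
      (Ball-+ (Ball-* (S-pᴺ N) (C-integral h)) (Ball-neg (Ball-* (C-pᴺ N) (S-integral h))))

    C⁻-0 : C⁻ 0 ≈ c
    C⁻-0 = R.trans (R.+-cong (R.*-congʳ (C-0 (fromℕ 0) R.refl)) (R.*-congʳ (S-0 (fromℕ 0) R.refl)))
      (solve 2 (λ c s → con 1ℚ :* c :+ con 0ℚ :* s := c) R.refl c s)

    S⁻-0 : S⁻ 0 ≈ (- s)
    S⁻-0 = R.trans
      (R.+-cong (R.*-congʳ (S-0 (fromℕ 0) R.refl)) (R.-‿cong (R.*-congʳ (C-0 (fromℕ 0) R.refl))))
      (solve 2 (λ c s → con 0ℚ :* c :- con 1ℚ :* s := :- s) R.refl c s)

    C-limit : fermionicSum C ⟶ 1#
    C-limit = fermionicSum-limit C C⁻ {c + c} {ι ½ * v} {c} {1#} 2c-inverse C-step C⁻-pᴺ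
      (R.trans (R.+-congʳ C⁻-0) (R.sym (R.*-identityʳ (c + c))))

    S-limit : fermionicSum S ⟶ (- (S h ÷ C h ⟨ c-invertible ⟩))
    S-limit = fermionicSum-limit S S⁻ {c + c} {ι ½ * v} { - s} { - (s * v)} 2c-inverse S-step S⁻-pᴺ
      (begin
        S⁻ 0 + (- s)               ≈⟨ R.+-congʳ S⁻-0 ⟩
        (- s) + (- s)              ≈⟨ solve 1 (λ s → :- s :+ :- s := con 1ℚ :* :- (s :+ s)) R.refl s ⟩
        1# * (- (s + s))           ≈⟨ R.*-congʳ vc≈1 ⟨
        (v * c) * (- (s + s))
          ≈⟨ solve 3 (λ v c s → (v :* c) :* :- (s :+ s) := (c :+ c) :* :- (s :* v)) R.refl v c s ⟩
        (c + c) * (- (s * v))      ∎)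
      where open ≈-R

    module DoubleAngle {c₂ s₂ : ℚₚ}
      (c₂≈ : c₂ ≈ (C h * C h - S h * S h))
      (s₂≈ : s₂ ≈ (S h * C h + C h * S h))
      where

      -- Writing the 1 as `c² + s²` cancels `s²`. Thus `cos a + 1` inherits invertibility from
      -- `cos t`, with inverse `½ v²`.
      c₂+1≈2c² : (c₂ + 1#) ≈ (c * c + c * c)
      c₂+1≈2c² = R.trans (R.+-cong c₂≈ (R.sym pythagoras))
        (solve 2 (λ c s → (c :* c :- s :* s) :+ (c :* c :+ s :* s) := c :* c :+ c :* c) R.refl c s)

      c₂+1-invertible : Invertible (c₂ + 1#)
      c₂+1-invertible = u , inverse , R.trans (R.*-comm (c₂ + 1#) u) inverse
        where
        u = ι ½ * (v * v)
        inverse : (u * (c₂ + 1#)) ≈ 1#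
        inverse = begin
          u * (c₂ + 1#)           ≈⟨ R.*-congˡ c₂+1≈2c² ⟩
          u * (c * c + c * c)
            ≈⟨ solve 2 (λ v c → (con ½ :* (v :* v)) :* (c :* c :+ c :* c) := (v :* c) :* (v :* c)) R.refl v c ⟩
          (v * c) * (v * c)       ≈⟨ R.*-cong vc≈1 vc≈1 ⟩
          1# * 1#                 ≈⟨ R.*-identityˡ 1# ⟩
          1#                      ∎
          where open ≈-R

      half-angle : (- (s₂ ÷ (c₂ + 1#) ⟨ c₂+1-invertible ⟩)) ≈ (- (S h ÷ C h ⟨ c-invertible ⟩))
      half-angle = R.-‿cong (begin
        s₂ * (ι ½ * (v * v))                  ≈⟨ R.*-congʳ s₂≈ ⟩
        (s * c + c * s) * (ι ½ * (v * v))
          ≈⟨ solve 3 (λ c s v → (s :* c :+ c :* s) :* (con ½ :* (v :* v)) := (v :* c) :* (s :* v)) R.refl c s v ⟩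
        (v * c) * (s * v)                     ≈⟨ R.*-congʳ vc≈1 ⟩
        1# * (s * v)                          ≈⟨ R.*-identityˡ (s * v) ⟩
        s * v                                 ∎)
        where open ≈-R

      S-limit₂ : fermionicSum S ⟶ (- (s₂ ÷ (c₂ + 1#) ⟨ c₂+1-invertible ⟩))
      S-limit₂ = ⟶-cong {fermionicSum S} (λ _ → R.refl) (R.sym half-angle) S-limit

  -- h is ½.  It is a variable because conversion checking at ½ₚ p-odd would unfold cos and sin
  -- down to the rational approximations of their values.
  integrals : (h : ℤₚ) → value h ≈ ι ½ → (a : Dom) → ∣ point a ∣≤p^- 0 →
    (∫ (λ x → cos (a · x)) dμ₋₁≈ 1#) ×
    (Σ[ u ∈ Invertible (cos a + 1#) ] Σ[ v ∈ Invertible (cos (a · h)) ]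
      (∫ (λ x → sin (a · x)) dμ₋₁≈ (- (sin a ÷ (cos a + 1#) ⟨ u ⟩))) ×
      ((- (sin a ÷ (cos a + 1#) ⟨ u ⟩)) ≈ (- tan (a · h) v)))
  integrals h h≈½ a a₀ =
    record { strictlyDifferentiable = cosₐ-strictlyDifferentiable {a} a-small ; limit = C-limit } ,
    c₂+1-invertible , c-invertible ,
    record { strictlyDifferentiable = sinₐ-strictlyDifferentiable {a} a-small ; limit = S-limit₂ } ,
    half-angle
    where
    open ℚₚ-Solver
    a-small : Small a
    a-small = integral⇒small a a₀
    point-neg : ∀ x → point (a · (-ℤ x)) ≈ (- point (a · x))
    point-neg x = solve 2 (λ a x → a :* :- x := :- (a :* x)) R.refl (point a) (value x)
    ½-small : Small (a · h)
    ½-small = ·-small {a} a-small h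
    a≈½a+½a : point a ≈ (point (a · h) + point (a · h))
    a≈½a+½a = R.trans (solve 1 (λ a → a := a :* con ½ :+ a :* con ½) R.refl (point a))
      (R.sym (R.+-cong (R.*-congˡ h≈½) (R.*-congˡ h≈½)))
    cos-close : ∀ {k} x → ∣ value x ∣≤p^- k → ∣ cos (a · x) - 1# ∣≤p^- k
    cos-close {k} x x-ball = Ball-weaken (ℕ.m≤m+n k (k ℕ.+ 0)) (cosₐ-1-ball {a} a-small x x-ball)
    sin-close : ∀ {k} x → ∣ value x ∣≤p^- k → ∣ sin (a · x) ∣≤p^- k
    sin-close {k} x x-ball = Ball-weaken (ℕ.n≤1+n k) (sin-ball (a · x) (·-ball {a} a-small x x-ball))
    open Fermionic {λ x → cos (a · x)} {λ x → sin (a · x)} {h} h≈½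
      (cosₐ-integral {a} a-small) (sinₐ-integral {a} a-small)
      (λ x → cos-1-ball (a · x) (·-small {a} a-small x)) cos-close sin-close
      (cosₐ-+ {a} a-small) (sinₐ-+ {a} a-small)
      (λ x → cos-neg (a · x) (a · (-ℤ x)) (point-neg x))
      (λ x → sin-neg (a · x) (a · (-ℤ x)) (point-neg x))
    open DoubleAngle {cos a} {sin a}
      (cos-+ {a · h} {a · h} {a} ½-small ½-small a-small a≈½a+½a)
      (sin-+ {a · h} {a · h} {a} ½-small ½-small a-small a≈½a+½a)

proposition12 : (p : ℕ) (p-prime : Prime p) (p-odd : ¬ (2 ∣ p)) →
    let open Padic p p-prime in
    (a : Dom) → ∣ point a ∣≤p^- 0 →
    (∫ (λ x → cos (a · x)) dμ₋₁≈ 1#) ×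
    (Σ[ u ∈ Invertible (cos a + 1#) ] Σ[ v ∈ Invertible (cos (a · ½ₚ p-odd)) ]
    (∫ (λ x → sin (a · x)) dμ₋₁≈ (- (sin a ÷ (cos a + 1#) ⟨ u ⟩))) ×
    ((- (sin a ÷ (cos a + 1#) ⟨ u ⟩)) ≈ (- tan (a · ½ₚ p-odd) v)))
-- The underscore stands for `½ₚ p-odd`, fixed by the goal; its value is `ι ½` by definition, so
-- reflexivity suffices.
proposition12 p p-prime p-odd = PadicTrigonometry.integrals p p-prime p-odd _ (Padic.R.refl p p-prime)
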